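{- Let $G$ be a finite simple edge-twin-free graph with $m$ edges and no isolated edge. Then $\gamma'_L(G)\le \frac{m}{2}$.
   Context: An isolated edge of $G$ is an edge both of whose ends have degree $1$. For an edge $e$, $N(e)$ is the set of edges different from $e$ sharing an end with $e$, and $N[e]=N(e)\cup\{e\}$. Distinct edges $e,f$ are edge-twins if $N(e)=N(f)$ or $N[e]=N[f]$; $G$ is edge-twin-free if it has no pair of edge-twins. A set $D\subseteq E(G)$ is an edge-locating-dominating set if every edge in $E(G)\setminus D$ shares an end with some edge of $D$, and for every two distinct edges $e,f\in E(G)\setminus D$ we have $N(e)\cap D\neq N(f)\cap D$. The edge-location-domination number $\gamma'_L(G)$ is the minimum cardinality of an edge-locating-dominating set of $G$. -}

module Defs where

open import Data.Nat using (ℕ; _<_)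
open import Data.Fin using (Fin; toℕ)
open import Data.Fin.Subset using (Subset; _∈_; _∉_; ∣_∣)
open import Data.Vec using (tabulate)
open import Data.Bool using (Bool; true; false)
open import Data.Product using (Σ; _×_; _,_; proj₁; proj₂; ∃)
open import Data.Sum using (_⊎_)
open import Relation.Nullary using (¬_; does)
open import Relation.Binary.PropositionalEquality using (_≡_; _≢_)
open import Data.Fin using (_≟_)
open import Data.Bool using (_∨_)
open import Function.Bundles using (_⇔_)

-- A finite simple graph with vertex set Fin n and edge set Fin m.
-- Edge i has endpoints (u , v) with u < v (no loops); distinct edges
-- have distinct endpoint pairs (no multiple edges).
record Graph (n m : ℕ) : Set where
  field
    ends      : Fin m → Fin n × Fin n
    ordered   : ∀ e → toℕ (proj₁ (ends e)) < toℕ (proj₂ (ends e))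
    injective : ∀ e f → ends e ≡ ends f → e ≡ f
open Graph public

module _ {n m : ℕ} (G : Graph n m) where

  incident : Fin n → Fin m → Set
  incident v e = (v ≡ proj₁ (ends G e)) ⊎ (v ≡ proj₂ (ends G e))

  incidentᵇ : Fin n → Fin m → Bool
  incidentᵇ v e = does (v ≟ proj₁ (ends G e)) ∨ does (v ≟ proj₂ (ends G e))

  degree : Fin n → ℕ
  degree v = ∣ tabulate (incidentᵇ v) ∣

  shareEnd : Fin m → Fin m → Set
  shareEnd e f = Σ (Fin n) λ v → incident v e × incident v f

  InN : Fin m → Fin m → Set
  InN e f = (f ≢ e) × shareEnd e f

  InN[] : Fin m → Fin m → Set
  InN[] e f = (f ≡ e) ⊎ InN e f

  IsolatedEdge : Fin m → Set
  IsolatedEdge e = (degree (proj₁ (ends G e)) ≡ 1) × (degree (proj₂ (ends G e)) ≡ 1)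

  NoIsolatedEdge : Set
  NoIsolatedEdge = ∀ e → ¬ IsolatedEdge e

  EdgeTwins : Fin m → Fin m → Set
  EdgeTwins e f = (e ≢ f) × ((∀ g → InN e g ⇔ InN f g) ⊎ (∀ g → InN[] e g ⇔ InN[] f g))

  EdgeTwinFree : Set
  EdgeTwinFree = ∀ e f → ¬ EdgeTwins e f

  IsEdgeLocDom : Subset m → Set
  IsEdgeLocDom D =
    (∀ e → e ∉ D → Σ (Fin m) λ g → (g ∈ D) × shareEnd e g)
    × (∀ e f → e ∉ D → f ∉ D → e ≢ f →
         ¬ (∀ g → g ∈ D → (InN e g ⇔ InN f g)))

{-# OPTIONS --safe #-}
-- Call a partial 2-colouring of the edges good if every coloured edge meets an
-- edge of the opposite colour, and two edges of the same colour never meet the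
-- same edges of the opposite colour.  If a good colouring is total then both
-- colour classes are edge-locating-dominating, and the smaller has at most m/2
-- edges.  So take a good colouring with as few uncoloured (white) edges as
-- possible.  Colouring further edges never spoils what is already separated,
-- so a white edge f cannot receive colour j only if it meets no edge of the
-- opposite colour i, or if it has a twin: an edge e of colour j meeting the same
-- edges of colour i as f.  In the latter case e and f can exchange their roles.
-- Comparing the obstructions in the two colours, either both twins are adjacent
-- to f, forming a star or a triangle with it, or none is; each time some
-- exchanges and recolourings produce a good colouring with fewer white edges.
module Submission where

open import Defs
open import Data.Nat using (ℕ; suc; _*_; _+_; _∸_; _≤_; _<_; s≤s)
open import Data.Nat.Induction using (Acc; acc; <-wellFounded)
import Data.Nat.Properties as ℕ
open import Data.Empty using (⊥; ⊥-elim)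
open import Data.Bool using (Bool; true; false; if_then_else_)
open import Data.Fin using (Fin; zero; suc; toℕ; _≟_) renaming (_<_ to _<ᶠ_)
open import Data.Fin.Properties using (any?; all?)
open import Data.Fin.Subset using (Subset; _∈_; _∉_; _⊆_; _∪_; ⁅_⁆; ∁; ∣_∣; inside; outside)
open import Data.Fin.Subset.Properties
  using (_∈?_; anySubset?; p⊆q⇒∣p∣≤∣q∣; p⊂q⇒∣p∣<∣q∣; ∪-identityʳ; x∈⁅x⁆; ∣⁅x⁆∣≡1;
         p⊆p∪q; q⊆p∪q; ∣∁p∣≡n∸∣p∣; x∈∁p⇒x∉p; x∉p⇒x∈∁p; x∉∁p⇒x∈p;
         ⊆-antisym; x∈⁅y⁆⇒x≡y)
open import Data.Maybe using (Maybe; just; nothing; is-nothing; fromMaybe)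
open import Data.Maybe.Properties using (just-injective)
open import Data.Product using (Σ; ∃; _×_; _,_; proj₁; proj₂)
open import Data.Sum using (_⊎_; inj₁; inj₂; [_,_]′; swap)
open import Data.Vec using (_∷_; tabulate)
open import Data.Vec.Properties using ([]=⇒lookup; lookup⇒[]=; lookup∘tabulate)
open import Function using (_∘_; id)
open import Function.Bundles using (_⇔_; mk⇔; Equivalence)
open import Relation.Binary.PropositionalEquality
  using (_≡_; _≢_; refl; sym; trans; cong; cong₂; subst; subst₂)
open import Relation.Nullary using (¬_; Dec; yes; no; does; contradiction)
open import Relation.Nullary.Decidable
  using (_×-dec_; _⊎-dec_; _→-dec_; ¬?; map′; decidable-stable; toSum; dec-true; dec-false)

-- Nearly every goal below is falsity, so a case distinction on an arbitrary proposition is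
-- available.
em : {P : Set} → (P → ⊥) → (¬ P → ⊥) → ⊥
em p⇒⊥ ¬p⇒⊥ = ¬p⇒⊥ p⇒⊥

∣p∪⁅x⁆∣≤1+∣p∣ : ∀ {m} (p : Subset m) x → ∣ p ∪ ⁅ x ⁆ ∣ ≤ suc ∣ p ∣
∣p∪⁅x⁆∣≤1+∣p∣ (inside  ∷ p) zero    rewrite ∪-identityʳ p = ℕ.n≤1+n _
∣p∪⁅x⁆∣≤1+∣p∣ (outside ∷ p) zero    rewrite ∪-identityʳ p = ℕ.≤-refl
∣p∪⁅x⁆∣≤1+∣p∣ (inside  ∷ p) (suc x) = s≤s (∣p∪⁅x⁆∣≤1+∣p∣ p x)
∣p∪⁅x⁆∣≤1+∣p∣ (outside ∷ p) (suc x) = ∣p∪⁅x⁆∣≤1+∣p∣ p x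

∈-tabulate⁺ : ∀ {m} {P : Fin m → Bool} {x} → P x ≡ true → x ∈ tabulate P
∈-tabulate⁺ {P = P} {x} eq = lookup⇒[]= x (tabulate P) (trans (lookup∘tabulate P x) eq)

∈-tabulate⁻ : ∀ {m} {P : Fin m → Bool} {x} → x ∈ tabulate P → P x ≡ true
∈-tabulate⁻ {P = P} {x} x∈ = trans (sym (lookup∘tabulate P x)) ([]=⇒lookup x∈)

-- Incidence in a simple graph.

module Incidence {n m : ℕ} (G : Graph n m) where

  infix 4 _∈ᵉ_ _~_

  _∈ᵉ_ : Fin n → Fin m → Set
  v ∈ᵉ e = incident G v e

  -- Reflexive, unlike `InN`; the two agree on edges of different colours, which are the only ones
  -- that goodness compares.
  record _~_ (e f : Fin m) : Set where
    constructor at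
    field
      {vertex} : Fin n
      inˡ : vertex ∈ᵉ e
      inʳ : vertex ∈ᵉ f

  _∈ᵉ?_ : ∀ v e → Dec (v ∈ᵉ e)
  v ∈ᵉ? e = (v ≟ proj₁ (ends G e)) ⊎-dec (v ≟ proj₂ (ends G e))

  _~?_ : ∀ e f → Dec (e ~ f)
  e ~? f = map′ (λ (_ , p , q) → at p q) (λ (at p q) → _ , p , q)
    (any? λ v → (v ∈ᵉ? e) ×-dec (v ∈ᵉ? f))

  ~-sym : ∀ {e f} → e ~ f → f ~ e
  ~-sym (at p q) = at q p

  ~-refl : ∀ {e} → e ~ e
  ~-refl = at (inj₁ refl) (inj₁ refl)

  record Joins (e : Fin m) (a b : Fin n) : Set where
    constructor joins
    field
      left  : a ∈ᵉ e
      right : b ∈ᵉ e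
      apart : a ≢ b
  open Joins public

  flip : ∀ {e a b} → Joins e a b → Joins e b a
  flip (joins p q r) = joins q p (r ∘ sym)

  ends-distinct : ∀ e → proj₁ (ends G e) ≢ proj₂ (ends G e)
  ends-distinct e eq = ℕ.<-irrefl (cong toℕ eq) (ordered G e)

  ends-cover : ∀ {e a b x} → Joins e a b → x ∈ᵉ e → x ≡ a ⊎ x ≡ b
  ends-cover (joins (inj₁ refl) (inj₁ refl) a≢b) _ = contradiction refl a≢b
  ends-cover (joins (inj₁ refl) (inj₂ refl) _) x∈ = x∈
  ends-cover (joins (inj₂ refl) (inj₁ refl) _) x∈ = swap x∈
  ends-cover (joins (inj₂ refl) (inj₂ refl) a≢b) _ = contradiction refl a≢b

  opposite : ∀ {e a} → a ∈ᵉ e → ∃ λ b → Joins e a b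
  opposite {e} p@(inj₁ refl) = _ , joins p (inj₂ refl) (ends-distinct e)
  opposite {e} p@(inj₂ refl) = _ , joins p (inj₁ refl) (ends-distinct e ∘ sym)

  no-parallel : ∀ {e f a b} → Joins e a b → a ∈ᵉ f → b ∈ᵉ f → e ≡ f
  no-parallel (joins (inj₁ p) (inj₁ q) a≢b) _ _ = contradiction (trans p (sym q)) a≢b
  no-parallel (joins (inj₂ p) (inj₂ q) a≢b) _ _ = contradiction (trans p (sym q)) a≢b
  no-parallel (joins _ _ a≢b) (inj₁ r) (inj₁ s) = contradiction (trans r (sym s)) a≢b
  no-parallel (joins _ _ a≢b) (inj₂ r) (inj₂ s) = contradiction (trans r (sym s)) a≢b
  no-parallel {e} {f} (joins (inj₁ p) (inj₂ q) _) (inj₁ r) (inj₂ s) =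
    injective G e f (cong₂ _,_ (trans (sym p) r) (trans (sym q) s))
  no-parallel {e} {f} (joins (inj₂ p) (inj₁ q) _) (inj₂ r) (inj₁ s) =
    injective G e f (cong₂ _,_ (trans (sym q) s) (trans (sym p) r))
  no-parallel {e} {f} (joins (inj₁ p) (inj₂ q) _) (inj₂ r) (inj₁ s) =
    contradiction (ordered G f)
      (ℕ.<-asym (subst₂ _<ᶠ_ (trans (sym p) r) (trans (sym q) s) (ordered G e)))
  no-parallel {e} {f} (joins (inj₂ p) (inj₁ q) _) (inj₁ r) (inj₂ s) =
    contradiction (ordered G f)
      (ℕ.<-asym (subst₂ _<ᶠ_ (trans (sym q) s) (trans (sym p) r) (ordered G e)))

  meets : ∀ {e g a b} → Joins e a b → e ~ g → a ∈ᵉ g ⊎ b ∈ᵉ g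
  meets J (at p q) with ends-cover J p
  ... | inj₁ refl = inj₁ q
  ... | inj₂ refl = inj₂ q

-- Partial colourings, the obstructions to extending them, and exchanges.

module Colouring {n m : ℕ} (G : Graph n m) where
  open Incidence G

  Colours : Set
  Colours = Fin m → Maybe Bool

  private variable
    c c′ : Colours
    e f g r : Fin m
    i j k : Bool

  same? : ∀ (e f : Fin m) → e ≡ f ⊎ e ≢ f
  same? e f = toSum (e ≟ f)

  infix 30 _[_≔_]

  opaque

    _[_≔_] : Colours → Fin m → Maybe Bool → Colours
    (c [ e ≔ x ]) g = if does (g ≟ e) then x else c g

    updated : ∀ c e {x} → (c [ e ≔ x ]) e ≡ x
    updated c e rewrite dec-true (e ≟ e) refl = refl

    unchanged : ∀ c {e g x} → g ≢ e → (c [ e ≔ x ]) g ≡ c g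
    unchanged c {e} {g} g≢e rewrite dec-false (g ≟ e) g≢e = refl

    inspect : ∀ c e {g x y} → (c [ e ≔ x ]) g ≡ y → (g ≡ e × x ≡ y) ⊎ (g ≢ e × c g ≡ y)
    inspect c e {g} p with g ≟ e
    ... | yes g≡e = inj₁ (g≡e , p)
    ... | no  g≢e = inj₂ (g≢e , p)

  keep : ∀ {x y} → g ≢ e → c g ≡ y → (c [ e ≔ x ]) g ≡ y
  keep {c = c} g≢e p = trans (unchanged c g≢e) p

  white≢ : c f ≡ nothing → c g ≡ just i → g ≢ f
  white≢ w p refl with trans (sym w) p
  ... | ()

  colour≢ : j ≢ i → c f ≡ just j → c g ≡ just i → f ≢ g
  colour≢ j≢i p q refl = j≢i (just-injective (trans (sym p) q))

  Empty : Colours → Bool → Fin m → Set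
  Empty c i e = ∀ g → c g ≡ just i → ¬ e ~ g

  record Twin (c : Colours) (i : Bool) (e f : Fin m) : Set where
    constructor twin
    field
      to   : ∀ {g} → c g ≡ just i → e ~ g → f ~ g
      from : ∀ {g} → c g ≡ just i → f ~ g → e ~ g
  open Twin public

  Twin-sym : Twin c i e f → Twin c i f e
  Twin-sym (twin p q) = twin q p

  Twin-trans : Twin c i e f → Twin c i f g → Twin c i e g
  Twin-trans (twin p q) (twin r s) = twin (λ x → r x ∘ p x) (λ x → q x ∘ s x)

  restrict : (∀ {g} → c g ≡ just i → c′ g ≡ just i) → Twin c′ i e f → Twin c i e f
  restrict old (twin p q) = twin (p ∘ old) (q ∘ old)

  record Located (c : Colours) (j i : Bool) : Set where
    field
      dominated : ∀ {e} → c e ≡ just j → ¬ Empty c i e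
      separated : ∀ {e f} → c e ≡ just j → c f ≡ just j → Twin c i e f → e ≡ f
  open Located public

  Good : Colours → Set
  Good c = ∀ {j i} → j ≢ i → Located c j i

  bool-cover : j ≢ i → ∀ k → k ≡ j ⊎ k ≡ i
  bool-cover {false} {false} j≢i _ = contradiction refl j≢i
  bool-cover {true}  {true}  j≢i _ = contradiction refl j≢i
  bool-cover {false} {true} _ false = inj₁ refl
  bool-cover {false} {true} _ true  = inj₂ refl
  bool-cover {true} {false} _ true  = inj₁ refl
  bool-cover {true} {false} _ false = inj₂ refl

  good : j ≢ i → Located c j i → Located c i j → Good c
  good {j} {i} j≢i l l′ {x} {y} x≢y with bool-cover j≢i x | bool-cover j≢i y
  ... | inj₁ refl | inj₁ refl = contradiction refl x≢y
  ... | inj₁ refl | inj₂ refl = l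
  ... | inj₂ refl | inj₁ refl = l′
  ... | inj₂ refl | inj₂ refl = contradiction refl x≢y

  -- Only changes can do harm. Edges in `New` have just received colour `j` and are checked from
  -- scratch. Edges in `Lost` may have given up colour `i`: an old edge needs attention only if it
  -- met one of them, and two old edges only if a lost edge could have told them apart.
  relocate : (New Lost : Fin m → Set)
    → Located c j i
    → (∀ {e} → c′ e ≡ just j → New e ⊎ c e ≡ just j)
    → (∀ {g} → c g ≡ just i → Lost g ⊎ c′ g ≡ just i)
    → (∀ {e} → New e → ¬ Empty c′ i e)
    → (∀ {e r} → New e → c′ r ≡ just j → e ≢ r → ¬ Twin c′ i e r)
    → (∀ {e g} → c e ≡ just j → c′ e ≡ just j → Lost g → e ~ g → ¬ Empty c′ i e)
    → (∀ {e r g} → c e ≡ just j → c′ e ≡ just j → c r ≡ just j → c′ r ≡ just j →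
         Lost g → Twin c′ i e r → e ~ g → r ~ g)
    → Located c′ j i
  dominated (relocate New Lost L new lost nd nt ld lt) p with new p
  ... | inj₁ N = nd N
  ... | inj₂ q = λ emp → dominated L q λ g s e~g →
    [ (λ l → ld q p l e~g emp) , (λ s′ → emp g s′ e~g) ]′ (lost s)
  separated (relocate {i = i} New Lost L new lost nd nt ld lt) {e} {r} p q t with new p | new q | e ≟ r
  ... | _ | _ | yes e≡r = e≡r
  ... | inj₁ N | _ | no e≢r = contradiction t (nt N q e≢r)
  ... | inj₂ _ | inj₁ N | no e≢r = contradiction (Twin-sym t) (nt N p (e≢r ∘ sym))
  ... | inj₂ p′ | inj₂ q′ | no _ = separated L p′ q′ (twin
    (λ s → [ (λ l → lt p′ p q′ q l t) , to t ]′ (lost s))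
    (λ s → [ (λ l → lt q′ q p′ p l (Twin-sym t)) , from t ]′ (lost s)))

  whites : Colours → Subset m
  whites c = tabulate (is-nothing ∘ c)

  -- Existence of such a colouring is only shown up to double negation; this is
  -- enough because the final statement is decidable.
  record Max (c : Colours) : Set where
    field
      isGood  : Good c
      maximal : ∀ {c′} → Good c′ → ¬ ∣ whites c′ ∣ < ∣ whites c ∣
  open Max public

  ∈-whites⁺ : c e ≡ nothing → e ∈ whites c
  ∈-whites⁺ p = ∈-tabulate⁺ (cong is-nothing p)

  ∈-whites⁻ : e ∈ whites c → c e ≡ nothing
  ∈-whites⁻ {e} {c} p with c e | ∈-tabulate⁻ {P = is-nothing ∘ c} p
  ... | nothing | _ = refl

  fewer : (∀ {e} → c′ e ≡ nothing → c e ≡ nothing) → c f ≡ nothing → c′ f ≡ just j →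
          ∣ whites c′ ∣ < ∣ whites c ∣
  fewer {c′} {c} sub w p = p⊂q⇒∣p∣<∣q∣
    ( (λ x∈ → ∈-whites⁺ (sub (∈-whites⁻ x∈))) , _ , ∈-whites⁺ w
    , λ x∈ → white≢ {c = c′} (∈-whites⁻ {c = c′} x∈) p refl )

  improve : Max c → Good c′ → (∀ {e} → c′ e ≡ nothing → c e ≡ nothing) →
            c f ≡ nothing → c′ f ≡ just j → ⊥
  improve {c} {c′} M good′ sub w p = maximal M good′ (fewer {c′ = c′} {c = c} sub w p)

  white-upd : ∀ {x k} → (c [ e ≔ just k ]) g ≡ nothing → c g ≡ x → x ≡ nothing
  white-upd {c} {e} p q with inspect c e p
  ... | inj₂ (_ , r) = trans (sym q) r

  module _ (M : Max c) (j≢i : j ≢ i) where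

    -- No edge loses its colour, so goodness can fail only at `f`. In use the last argument is a
    -- continuation: it receives a twin of `f` and has to refute it.
    add : c f ≡ nothing → ¬ Empty c i f →
          (∀ {e} → c e ≡ just j → ¬ Twin c i f e) → ⊥
    add {f} w nonempty no-twin = improve M (good j≢i
        (relocate (_≡ f) (λ _ → ⊥) (isGood M j≢i) new (inj₂ ∘ old)
          (λ { refl emp → nonempty λ g s → emp g (old s) })
          (λ { refl p f≢r t → no-twin ([ (λ r≡f → contradiction (sym r≡f) f≢r) , id ]′ (new p)) (restrict old t) })
          (λ _ _ ()) (λ _ _ _ _ ()))
        (relocate (λ _ → ⊥) (λ _ → ⊥) (isGood M (j≢i ∘ sym))
          (inj₂ ∘ new′) (inj₂ ∘ old) (λ ()) (λ ()) (λ _ _ ()) (λ _ _ _ _ ())))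
      (λ p → white-upd {c = c} p refl) w (updated c f)
      where
      d : Colours
      d = c [ f ≔ just j ]
      old : ∀ {g k} → c g ≡ just k → d g ≡ just k
      old p = keep {c = c} (white≢ {c = c} w p) p
      new : ∀ {g} → d g ≡ just j → g ≡ f ⊎ c g ≡ just j
      new p = [ (λ (q , _) → inj₁ q) , (λ (_ , q) → inj₂ q) ]′ (inspect c f p)
      new′ : ∀ {g} → d g ≡ just i → c g ≡ just i
      new′ p = [ (λ (_ , q) → contradiction (just-injective q) j≢i) , proj₂ ]′ (inspect c f p)

    -- The two new edges help each other: if they meet, each dominates the other, and a twin
    -- obstructing `f` must also agree with `f` about meeting `g`, and vice versa. This is how a
    -- white edge that distinguishes two others is exploited.
    pairAdd : c f ≡ nothing → c g ≡ nothing → f ≢ g →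
      (¬ f ~ g → ¬ Empty c i f) →
      (∀ {e} → c e ≡ just j → Twin c i f e → (f ~ g → e ~ g) → (e ~ g → f ~ g) → ⊥) →
      (¬ f ~ g → ¬ Empty c j g) →
      (∀ {e} → c e ≡ just i → Twin c j g e → (g ~ f → e ~ f) → (e ~ f → g ~ f) → ⊥) →
      ⊥
    pairAdd {f} {g} wf wg f≢g domf twinf domg twing = improve M (good j≢i
        (relocate (_≡ f) (λ _ → ⊥) (isGood M j≢i) newj (inj₂ ∘ old)
          (λ { refl emp → domf (emp _ isg) λ g s → emp g (old s) })
          (λ { refl p f≢r t → twinf ([ (λ r≡f → contradiction (sym r≡f) f≢r) , id ]′ (newj p))
                 (restrict old t) (to t isg) (from t isg) })
          (λ _ _ ()) (λ _ _ _ _ ()))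
        (relocate (_≡ g) (λ _ → ⊥) (isGood M (j≢i ∘ sym)) newi (inj₂ ∘ old)
          (λ { refl emp → domg (emp _ isf ∘ ~-sym) λ g s → emp g (old s) })
          (λ { refl p f≢r t → twing ([ (λ r≡f → contradiction (sym r≡f) f≢r) , id ]′ (newi p))
                 (restrict old t) (to t isf) (from t isf) })
          (λ _ _ ()) (λ _ _ _ _ ())))
      (λ p → white-upd {c = c} (white-upd {c = c [ f ≔ just j ]} p refl) refl) wg isg
      where
      d : Colours
      d = c [ f ≔ just j ] [ g ≔ just i ]
      isg : d g ≡ just i
      isg = updated (c [ f ≔ just j ]) g
      isf : d f ≡ just j
      isf = keep {c = c [ f ≔ just j ]} f≢g (updated c f)
      old : ∀ {e k} → c e ≡ just k → d e ≡ just k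
      old p = keep {c = c [ f ≔ just j ]} (white≢ {c = c} wg p) (keep {c = c} (white≢ {c = c} wf p) p)
      newj : ∀ {e} → d e ≡ just j → e ≡ f ⊎ c e ≡ just j
      newj p with inspect (c [ f ≔ just j ]) g p
      ... | inj₁ (_ , q) = contradiction (sym (just-injective q)) j≢i
      ... | inj₂ (_ , q) with inspect c f q
      ... | inj₁ (r , _) = inj₁ r
      ... | inj₂ (_ , r) = inj₂ r
      newi : ∀ {e} → d e ≡ just i → e ≡ g ⊎ c e ≡ just i
      newi p with inspect (c [ f ≔ just j ]) g p
      ... | inj₁ (q , _) = inj₁ q
      ... | inj₂ (_ , q) with inspect c f q
      ... | inj₁ (_ , r) = contradiction (just-injective r) j≢i
      ... | inj₂ (_ , r) = inj₂ r

    -- An edge of colour `i` meets `f` exactly when it meets `e`, so `f` takes over every duty of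
    -- `e`.
    module Swap {f e} (w : c f ≡ nothing) (p : c e ≡ just j) (t : Twin c i f e) where

      private
        d₁ : Colours
        d₁ = c [ f ≔ just j ]

      d : Colours
      d = d₁ [ e ≔ nothing ]

      f≢e : f ≢ e
      f≢e = white≢ {c = c} w p ∘ sym

      swap-f : d f ≡ just j
      swap-f = keep {c = d₁} f≢e (updated c f)

      swap-e : d e ≡ nothing
      swap-e = updated d₁ e

      swap-i : ∀ {g} → c g ≡ just i → d g ≡ just i
      swap-i q = keep {c = d₁} (colour≢ {c = c} j≢i p q ∘ sym) (keep {c = c} (white≢ {c = c} w q) q)

      swap-j : ∀ {g} → g ≢ e → c g ≡ just j → d g ≡ just j
      swap-j g≢e q = keep {c = d₁} g≢e (keep {c = c} (white≢ {c = c} w q) q)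

      swap-white : ∀ {g} → g ≢ f → c g ≡ nothing → d g ≡ nothing
      swap-white {g} g≢f q with same? g e
      ... | inj₁ refl = swap-e
      ... | inj₂ g≢e = keep {c = d₁} g≢e (keep {c = c} g≢f q)

      unswap : ∀ {g k} → d g ≡ just k → (g ≡ f × k ≡ j) ⊎ (c g ≡ just k × g ≢ e × g ≢ f)
      unswap q with inspect d₁ e q
      ... | inj₂ (g≢e , q) with inspect c f q
      ... | inj₁ (g≡f , r) = inj₁ (g≡f , just-injective (sym r))
      ... | inj₂ (g≢f , r) = inj₂ (r , g≢e , g≢f)

      unswap-i : ∀ {g} → d g ≡ just i → c g ≡ just i
      unswap-i q with unswap q
      ... | inj₁ (_ , i≡j) = contradiction (sym i≡j) j≢i
      ... | inj₂ (r , _) = r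

      unswap-j : ∀ {g} → d g ≡ just j → g ≡ f ⊎ (c g ≡ just j × g ≢ e)
      unswap-j q with unswap q
      ... | inj₁ (g≡f , _) = inj₁ g≡f
      ... | inj₂ (r , g≢e , _) = inj₂ (r , g≢e)

      swap-good : Good d
      swap-good = good j≢i
        (relocate (_≡ f) (λ _ → ⊥) (isGood M j≢i)
          (λ q → [ inj₁ , inj₂ ∘ proj₁ ]′ (unswap-j q)) (inj₂ ∘ swap-i)
          (λ { refl emp → dominated (isGood M j≢i) p λ g s e~g → emp g (swap-i s) (from t s e~g) })
          (λ { refl q f≢r t′ → [ (λ r≡f → f≢r (sym r≡f))
                               , (λ (q′ , r≢e) → r≢e (separated (isGood M j≢i) q′ p (Twin-sym (Twin-trans (Twin-sym t) (restrict swap-i t′))))) ]′ (unswap-j q) })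
          (λ _ _ ()) (λ _ _ _ _ ()))
        (relocate (λ _ → ⊥) (_≡ e) (isGood M (j≢i ∘ sym))
          (inj₂ ∘ unswap-i) lost (λ ()) (λ ())
          (λ { q _ refl b~e emp → emp _ swap-f (~-sym (from t q (~-sym b~e))) })
          (λ { q _ q′ _ refl t′ b~e → ~-sym (to t q′ (~-sym (to t′ swap-f (~-sym (from t q (~-sym b~e)))))) }))
        where
        lost : ∀ {g} → c g ≡ just j → g ≡ e ⊎ d g ≡ just j
        lost {g} q = [ inj₁ , (λ g≢e → inj₂ (swap-j g≢e q)) ]′ (same? g e)

      -- One edge leaves the white set and one enters it, so a colouring better than `d` would beat
      -- `c` too.
      swap-max : Max d
      isGood swap-max = swap-good
      maximal swap-max {c′} good′ lt = maximal M good′ (ℕ.≤-trans lt (ℕ.≤-trans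
        (p⊆q⇒∣p∣≤∣q∣ {p = whites d} {q = whites d₁ ∪ ⁅ e ⁆} sub)
        (ℕ.≤-trans (∣p∪⁅x⁆∣≤1+∣p∣ (whites d₁) e)
          (fewer {c′ = d₁} {c = c} (λ q → white-upd {c = c} q refl) w (updated c f)))))
        where
        sub : whites d ⊆ whites d₁ ∪ ⁅ e ⁆
        sub {x} x∈ with inspect d₁ e {x} (∈-whites⁻ {c = d} x∈)
        ... | inj₁ (refl , _) = q⊆p∪q (whites d₁) ⁅ e ⁆ (x∈⁅x⁆ e)
        ... | inj₂ (_ , q) = p⊆p∪q ⁅ e ⁆ (∈-whites⁺ {c = d₁} q)

-- Recolourings around a white edge.

module Moves {n m : ℕ} (G : Graph n m) where
  open Incidence G
  open Colouring G

  -- Colour j is called red and colour i blue throughout.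
  module At {c : Colours} (M : Max c) {j i : Bool} (j≢i : j ≢ i) where

    private variable
      e f g h r b b′ : Fin m
      k : Bool
      u v z : Fin n

    White Red Blue : Fin m → Set
    White e = c e ≡ nothing
    Red e = c e ≡ just j
    Blue e = c e ≡ just i

    Bare : Fin n → Set
    Bare v = ∀ {e k} → v ∈ᵉ e → c e ≢ just k

    clash : Red e → Blue e → ⊥
    clash p q = j≢i (just-injective (trans (sym p) q))

    wclash : White e → c e ≢ just k
    wclash w p = white≢ {c = c} w p refl

    -- Simplicity as used from here on: two edges of different status, being distinct, cannot share
    -- both ends.
    only : Joins e u v → c e ≡ nothing → c g ≡ just k → u ∈ᵉ g → ¬ v ∈ᵉ g
    only J w p x y with no-parallel J x y
    ... | refl = wclash w p

    redblue : Joins e u v → Red e → Blue g → u ∈ᵉ g → ¬ v ∈ᵉ g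
    redblue J p q x y with no-parallel J x y
    ... | refl = clash p q

    bluered : Joins e u v → Blue e → Red g → u ∈ᵉ g → ¬ v ∈ᵉ g
    bluered J p q x y with no-parallel J x y
    ... | refl = clash q p

    -- `h` turns blue and `f` red. As they meet, they dominate each other; it remains to separate
    -- each from the old edges of its class and to see that blue edges manage without the red `h`.
    module Flip (w : White f) (p : Red h) (f~h : f ~ h) where

      private d₁ : Colours
      d₁ = c [ h ≔ just i ]

      d : Colours
      d = d₁ [ f ≔ just j ]

      private
        f≢h : f ≢ h
        f≢h = white≢ {c = c} w p ∘ sym

      d-f : d f ≡ just j
      d-f = updated d₁ f

      d-h : d h ≡ just i
      d-h = keep {c = d₁} (f≢h ∘ sym) (updated c h)

      d-red : g ≢ h → Red g → d g ≡ just j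
      d-red g≢h q = keep {c = d₁} (white≢ {c = c} w q) (keep {c = c} g≢h q)

      d-blue : Blue g → d g ≡ just i
      d-blue q = keep {c = d₁} (white≢ {c = c} w q) (keep {c = c} (colour≢ {c = c} j≢i p q ∘ sym) q)

      private
        from-red : d g ≡ just j → g ≡ f ⊎ (Red g × g ≢ h)
        from-red {g} q with inspect d₁ f {g} q
        ... | inj₁ (g≡f , _) = inj₁ g≡f
        ... | inj₂ (_ , q) with inspect c h {g} q
        ... | inj₁ (_ , i≡j) = contradiction (sym (just-injective i≡j)) j≢i
        ... | inj₂ (g≢h , q) = inj₂ (q , g≢h)

        from-blue : d g ≡ just i → g ≡ h ⊎ Blue g
        from-blue {g} q with inspect d₁ f {g} q
        ... | inj₁ (_ , j≡i) = contradiction (just-injective j≡i) j≢i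
        ... | inj₂ (_ , q) with inspect c h {g} q
        ... | inj₁ (g≡h , _) = inj₁ g≡h
        ... | inj₂ (_ , q) = inj₂ q

        lost : Red g → g ≡ h ⊎ d g ≡ just j
        lost {g} q = [ inj₁ , (λ g≢h → inj₂ (d-red g≢h q)) ]′ (same? g h)

      flip-add :
        (∀ {r} → Red r → r ≢ h → ¬ Twin d i f r) →
        (∀ {b} → Blue b → ¬ Twin d j h b) →
        (∀ {b} → Blue b → b ~ h → ¬ Empty d j b) →
        (∀ {b b′} → Blue b → Blue b′ → Twin d j b b′ → b ~ h → b′ ~ h) → ⊥
      flip-add twin-f twin-h dom loc = improve M (good j≢i
        (relocate (_≡ f) (λ _ → ⊥) (isGood M j≢i)
          (λ q → [ inj₁ , inj₂ ∘ proj₁ ]′ (from-red q)) (inj₂ ∘ d-blue)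
          (λ { refl emp → emp _ d-h f~h })
          (λ { refl q f≢r t → [ (λ r≡f → f≢r (sym r≡f)) , (λ (q′ , r≢h) → twin-f q′ r≢h t) ]′ (from-red q) })
          (λ _ _ ()) (λ _ _ _ _ ()))
        (relocate (_≡ h) (_≡ h) (isGood M (j≢i ∘ sym))
          from-blue lost
          (λ { refl emp → emp _ d-f (~-sym f~h) })
          (λ { refl q h≢r t → [ (λ r≡h → h≢r (sym r≡h)) , (λ q′ → twin-h q′ t) ]′ (from-blue q) })
          (λ { q _ refl b~h → dom q b~h })
          (λ { q _ q′ _ refl t → loc q q′ t })))
        (λ q → white-upd {c = c} (white-upd {c = d₁} q refl) refl) w d-f

    -- `q` and `f` turn red and `h` blue. The new edges dominate one another through `h`, but red
    -- edges lose `q` and blue edges lose `h`, so old edges of both colours must be rechecked.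
    module Flip₂ {q} (w : White f) (p : Red h) (pq : Blue q) (f~h : f ~ h) (q~h : q ~ h) where

      private d₀ d₁ : Colours
      d₀ = c [ q ≔ just j ]
      d₁ = d₀ [ h ≔ just i ]

      d : Colours
      d = d₁ [ f ≔ just j ]

      private
        f≢h : f ≢ h
        f≢h = white≢ {c = c} w p ∘ sym
        f≢q : f ≢ q
        f≢q = white≢ {c = c} w pq ∘ sym
        h≢q : h ≢ q
        h≢q = colour≢ {c = c} j≢i p pq

      d-f : d f ≡ just j
      d-f = updated d₁ f

      d-h : d h ≡ just i
      d-h = keep {c = d₁} (f≢h ∘ sym) (updated d₀ h)

      d-q : d q ≡ just j
      d-q = keep {c = d₁} (f≢q ∘ sym) (keep {c = d₀} (h≢q ∘ sym) (updated c q))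

      d-red : g ≢ h → Red g → d g ≡ just j
      d-red g≢h x = keep {c = d₁} (white≢ {c = c} w x) (keep {c = d₀} g≢h
        (keep {c = c} (colour≢ {c = c} j≢i x pq) x))

      d-blue : g ≢ q → Blue g → d g ≡ just i
      d-blue g≢q x = keep {c = d₁} (white≢ {c = c} w x) (keep {c = d₀}
        (colour≢ {c = c} j≢i p x ∘ sym) (keep {c = c} g≢q x))

      private
        from-red : d g ≡ just j → (g ≡ f ⊎ g ≡ q) ⊎ (Red g × g ≢ h)
        from-red {g} x with inspect d₁ f {g} x
        ... | inj₁ (g≡f , _) = inj₁ (inj₁ g≡f)
        ... | inj₂ (_ , x) with inspect d₀ h {g} x
        ... | inj₁ (_ , i≡j) = contradiction (sym (just-injective i≡j)) j≢i
        ... | inj₂ (g≢h , x) with inspect c q {g} x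
        ... | inj₁ (g≡q , _) = inj₁ (inj₂ g≡q)
        ... | inj₂ (_ , x) = inj₂ (x , g≢h)

        from-blue : d g ≡ just i → g ≡ h ⊎ (Blue g × g ≢ q)
        from-blue {g} x with inspect d₁ f {g} x
        ... | inj₁ (_ , j≡i) = contradiction (just-injective j≡i) j≢i
        ... | inj₂ (_ , x) with inspect d₀ h {g} x
        ... | inj₁ (g≡h , _) = inj₁ g≡h
        ... | inj₂ (_ , x) with inspect c q {g} x
        ... | inj₁ (_ , j≡i) = contradiction (just-injective j≡i) j≢i
        ... | inj₂ (g≢q , x) = inj₂ (x , g≢q)

        lost-red : Red g → g ≡ h ⊎ d g ≡ just j
        lost-red {g} x = [ inj₁ , (λ g≢h → inj₂ (d-red g≢h x)) ]′ (same? g h)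

        lost-blue : Blue g → g ≡ q ⊎ d g ≡ just i
        lost-blue {g} x = [ inj₁ , (λ g≢q → inj₂ (d-blue g≢q x)) ]′ (same? g q)

        survives : Red g → d g ≡ just j → g ≢ h
        survives {g} x y = colour≢ {c = d} {f = g} {g = h} j≢i y d-h

        survives′ : Blue g → d g ≡ just i → g ≢ q
        survives′ {g} x y = colour≢ {c = d} {f = q} {g = g} j≢i d-q y ∘ sym

      flip₂-add :
        ¬ Twin d i f q →
        (∀ {r} → Red r → r ≢ h → ¬ Twin d i f r) →
        (∀ {r} → Red r → r ≢ h → ¬ Twin d i q r) →
        (∀ {b} → Blue b → b ≢ q → ¬ Twin d j h b) →
        (∀ {r} → Red r → r ≢ h → r ~ q → ¬ Empty d i r) →
        (∀ {r r′} → Red r → r ≢ h → Red r′ → r′ ≢ h → Twin d i r r′ → r ~ q → r′ ~ q) →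
        (∀ {b} → Blue b → b ≢ q → b ~ h → ¬ Empty d j b) →
        (∀ {b b′} → Blue b → b ≢ q → Blue b′ → b′ ≢ q → Twin d j b b′ → b ~ h → b′ ~ h) → ⊥
      flip₂-add twin-fq twin-f twin-q twin-h domr locr domb locb = improve M (good j≢i
        (relocate (λ g → g ≡ f ⊎ g ≡ q) (_≡ q) (isGood M j≢i)
          (λ x → [ inj₁ , inj₂ ∘ proj₁ ]′ (from-red x)) lost-blue
          (λ { (inj₁ refl) emp → emp _ d-h f~h ; (inj₂ refl) emp → emp _ d-h q~h })
          new-twin
          (λ { x y refl → domr x (survives x y) })
          (λ { x y x′ y′ refl → locr x (survives x y) x′ (survives x′ y′) }))
        (relocate (_≡ h) (_≡ h) (isGood M (j≢i ∘ sym))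
          (λ x → [ inj₁ , inj₂ ∘ proj₁ ]′ (from-blue x)) lost-red
          (λ { refl emp → emp _ d-f (~-sym f~h) })
          (λ { refl x h≢r t → [ (λ r≡h → h≢r (sym r≡h)) , (λ (x′ , r≢q) → twin-h x′ r≢q t) ]′ (from-blue x) })
          (λ { x y refl → domb x (survives′ x y) })
          (λ { x y x′ y′ refl → locb x (survives′ x y) x′ (survives′ x′ y′) })))
        (λ {e} x → white-upd {c = c} {q} {e} (white-upd {c = d₀} {h} {e} (white-upd {c = d₁} {f} {e} x refl) refl) refl) w d-f
        where
        new-twin : ∀ {e r} → e ≡ f ⊎ e ≡ q → d r ≡ just j → e ≢ r → ¬ Twin d i e r
        new-twin {r = r} N x e≢r t with N | from-red {r} x
        ... | inj₁ refl | inj₁ (inj₁ refl) = e≢r refl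
        ... | inj₁ refl | inj₁ (inj₂ refl) = twin-fq t
        ... | inj₁ refl | inj₂ (x′ , r≢h) = twin-f x′ r≢h t
        ... | inj₂ refl | inj₁ (inj₁ refl) = twin-fq (Twin-sym t)
        ... | inj₂ refl | inj₁ (inj₂ refl) = e≢r refl
        ... | inj₂ refl | inj₂ (x′ , r≢h) = twin-q x′ r≢h t

    -- Since `r` and `b` meet at `z`, the twin relations make `f` meet both. As `v` is bare this
    -- happens at `u`, and `r` and `b` would be parallel.
    twins-at-z : Joins f u v → Bare v → Red r → z ∈ᵉ r → u ≢ z → Twin c i f r →
                 Blue b → z ∈ᵉ b → Twin c j f b → ⊥
    twins-at-z Jf bare pr z∈r u≢z tr pb z∈b tb with meets Jf (from tb pr (at z∈b z∈r)) | meets Jf (from tr pb (at z∈r z∈b))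
    ... | inj₂ v∈r | _ = bare v∈r pr
    ... | _ | inj₂ v∈b = bare v∈b pb
    ... | inj₁ u∈r | inj₁ u∈b = redblue (joins u∈r z∈r u≢z) pr pb u∈b z∈b

    -- Blue edges met by `e` are met by `f`, hence contain `u`; those met by `r` contain `z`. So `e`
    -- and `r` are twins and coincide in an edge `uz`; a blue edge dominating it would be parallel
    -- to it.
    twins-at-uz : Joins f u v → Joins g z v → Bare v → u ≢ z →
                  Red e → z ∈ᵉ e → Twin c i f e → Red r → u ∈ᵉ r → Twin c i g r → ⊥
    twins-at-uz {f} {u} {v} {g} {z} {e} {r} Jf Jg bare u≢z pe z∈e te pr u∈r tr
      with separated (isGood M j≢i) pe pr (twin
             (λ q x → at u∈r (u∈ q x)) (λ q x → at z∈e (z∈ q x)))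
      where
      u∈ : ∀ {x} → Blue x → e ~ x → u ∈ᵉ x
      u∈ q x = [ id , (λ v∈x → contradiction q (bare v∈x)) ]′ (meets Jf (from te q x))
      z∈ : ∀ {x} → Blue x → r ~ x → z ∈ᵉ x
      z∈ q x = [ id , (λ v∈x → contradiction q (bare v∈x)) ]′ (meets Jg (from tr q x))
    ... | refl = dominated (isGood M j≢i) pe λ x q e~x →
      [ (λ u∈x → [ (λ z∈x → redblue (joins u∈r z∈e u≢z) pe q u∈x z∈x) , (λ v∈x → bare v∈x q) ]′ (meets Jg (from tr q e~x)))
      , (λ v∈x → bare v∈x q) ]′ (meets Jf (from te q e~x))

  module _ {c : Colours} (M : Max c) {j i : Bool} (j≢i : j ≢ i) where
    open At M j≢i
    private
      module I = At M (j≢i ∘ sym)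

    -- If neither way of giving f and g opposite colours works, then two of the
    -- twins blocking them are forced to be the same edge.
    joint : ∀ {f g u v z} → White f → White g → Joins f u v → Joins g z v → u ≢ z → Bare v → ⊥
    joint {f} {g} {u} {v} {z} wf wg Jf Jg u≢z bare =
      pairAdd M j≢i wf wg f≢g (λ ≁ → contradiction f~g ≁)
        (λ pe te e→ _ → let z∈e = z∈ pe (e→ f~g) in
          pairAdd M i≢j wf wg f≢g (λ ≁ → contradiction f~g ≁)
            (λ pb tb b→ _ → twins-at-z Jf bare pe z∈e u≢z te pb (z∈ pb (b→ f~g)) tb)
            (λ ≁ → contradiction f~g ≁)
            (λ pr tr r→ _ → twins-at-uz Jf Jg bare u≢z pe z∈e te pr (u∈ pr (r→ (~-sym f~g))) tr))
        (λ ≁ → contradiction f~g ≁)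
        (λ pb tb b→ _ → let u∈b = u∈ pb (b→ (~-sym f~g)) in
          pairAdd M i≢j wf wg f≢g (λ ≁ → contradiction f~g ≁)
            (λ pe te e→ _ → I.twins-at-uz Jf Jg bare u≢z pe (z∈ pe (e→ f~g)) te pb u∈b tb)
            (λ ≁ → contradiction f~g ≁)
            (λ pr tr r→ _ → twins-at-z Jg bare pr (u∈ pr (r→ (~-sym f~g))) (u≢z ∘ sym) tr pb u∈b tb))
      where
      i≢j = j≢i ∘ sym
      f~g : f ~ g
      f~g = at (right Jf) (right Jg)
      f≢g : f ≢ g
      f≢g refl = [ u≢z , apart Jf ]′ (ends-cover Jg (left Jf))
      z∈ : ∀ {e k} → c e ≡ just k → e ~ g → z ∈ᵉ e
      z∈ p x = [ id , (λ v∈e → contradiction p (bare v∈e)) ]′ (meets Jg (~-sym x))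
      u∈ : ∀ {e k} → c e ≡ just k → e ~ f → u ∈ᵉ e
      u∈ p x = [ id , (λ v∈e → contradiction p (bare v∈e)) ]′ (meets Jf (~-sym x))

-- Twins forming a triangle with the white edge.

module Adjacent {n m : ℕ} (G : Graph n m) (twin-free : EdgeTwinFree G) where
  open Incidence G
  open Colouring G
  open Moves G

  Splits : Fin m → Fin m → Fin m → Set
  Splits g e f = e ~ g × ¬ f ~ g

  -- The closed-neighbourhood half of twin-freeness, arranged for use under a falsity goal.
  split-adjacent : ∀ {e f} → e ≢ f → e ~ f → (∀ {g} → Splits g e f ⊎ Splits g f e → ⊥) → ⊥
  split-adjacent {e} {f} e≢f e~f none = twin-free e f (e≢f , inj₂ λ g → mk⇔ (half e≢f e~f inj₁) (half (e≢f ∘ sym) (~-sym e~f) inj₂))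
    where
    half : ∀ {e f} → e ≢ f → e ~ f → (∀ {g} → Splits g e f → Splits g _ _ ⊎ Splits g _ _) → ∀ {g} → InN[] G e g → InN[] G f g
    half e≢f e~f inj (inj₁ refl) = inj₂ (e≢f , _ , _~_.inʳ e~f , _~_.inˡ e~f)
    half {e} {f} e≢f e~f inj {g} (inj₂ (g≢e , v , p , q)) with g ≟ f | f ~? g
    ... | yes g≡f | _ = inj₁ g≡f
    ... | no  g≢f | yes (at r s) = inj₂ (g≢f , _ , r , s)
    ... | no  _   | no f≁g = ⊥-elim (none (inj (at p q , f≁g)))

  module _ {c : Colours} (M : Max c) {j i : Bool} (j≢i : j ≢ i) where
    open At M j≢i
    private
      i≢j : i ≢ j
      i≢j = j≢i ∘ sym

    -- The closed twins f, e′ of a triangle whose vertices v, w carry no further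
    -- coloured edge must be split by a white edge g; colour f and g oppositely.
    spare : ∀ {f e e′ h p g u v y w z} →
      White f → Red e → Blue e′ → Red h → Blue p →
      Joins f u v → Joins e u y → Joins e′ u w → Joins h v w → u ∈ᵉ p → p ≢ e′ →
      (∀ {x k} → c x ≡ just k → v ∈ᵉ x → x ≡ h) →
      (∀ {x k} → c x ≡ just k → w ∈ᵉ x → x ≡ h ⊎ x ≡ e′) →
      (∀ {x} → Blue x → ¬ y ∈ᵉ x) →
      White g → Joins g v z → z ≢ u → z ≢ w → ⊥
    spare {f} {e} {e′} {h} {p} {g} {u} {v} {y} {w} {z} wf pe pe′ ph pp Jf Je Je′ Jh u∈p p≢e′ colv colw noby wg Jg z≢u z≢w =
      pairAdd M j≢i wf wg f≢g (λ ≁ → contradiction f~g ≁) twinf (λ ≁ → contradiction f~g ≁) twing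
      where
      f~g : f ~ g
      f~g = at (right Jf) (left Jg)
      f≢g : f ≢ g
      f≢g refl = [ apart Jf , z≢u ∘ sym ]′ (ends-cover Jg (left Jf))
      u∉h : ¬ u ∈ᵉ h
      u∉h u∈h = only Jf wf ph u∈h (left Jh)
      v∉blue : ∀ {x} → Blue x → ¬ v ∈ᵉ x
      v∉blue q v∈x with colv q v∈x
      ... | refl = clash ph q
      g≁e′ : ¬ g ~ e′
      g≁e′ x with meets Jg x
      ... | inj₁ v∈e′ = v∉blue pe′ v∈e′
      ... | inj₂ z∈e′ = [ z≢u , z≢w ]′ (ends-cover Je′ z∈e′)
      -- Fallback with `f` blue and `g` red: a blue twin of `f` would have to meet `g` at `v` or
      -- `z`, and a red twin of `g` would meet `e′`, which `g` does not.
      second : (∀ {x} → Blue x → ¬ z ∈ᵉ x) → ⊥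
      second z∉blue = pairAdd M i≢j wf wg f≢g (λ ≁ → contradiction f~g ≁)
        (λ q _ x _ → [ v∉blue q , z∉blue q ]′ (meets Jg (~-sym (x f~g))))
        (λ ≁ → contradiction f~g ≁)
        λ { {r} q t x _ → g≁e′ (from t pe′
          ([ (λ u∈r → at u∈r (left Je′))
           , (λ v∈r → subst (_~ e′) (sym (colv q v∈r)) (at (right Jh) (right Je′))) ]′ (meets Jf (~-sym (x (~-sym f~g)))))) }
      twinf : ∀ {x} → Red x → Twin c i f x → (f ~ g → x ~ g) → (x ~ g → f ~ g) → ⊥
      twinf q t x _ with meets Jg (~-sym (x f~g))
      ... | inj₁ v∈x with colv q v∈x
      -- The candidate twin is `h`, but `f` meets `p` and `h` does not.
      ... | refl with meets Jh (to t pp (at (left Jf) u∈p))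
      ... | inj₁ v∈p = v∉blue pp v∈p
      ... | inj₂ w∈p = [ (λ { refl → clash ph pp }) , p≢e′ ]′ (colw pp w∈p)
      twinf q t x _ | inj₂ z∈x with meets Je′ (~-sym (to t pe′ (at (left Jf) (left Je′))))
      ... | inj₂ w∈x with colw q w∈x
      ... | inj₂ refl = clash q pe′
      ... | inj₁ refl = [ (apart Jg ∘ sym) , z≢w ]′ (ends-cover Jh z∈x)
      twinf q t x _ | inj₂ z∈x | inj₁ u∈x = second λ b z∈b →
        [ (λ u∈b → redblue (joins u∈x z∈x (z≢u ∘ sym)) q b u∈b z∈b) , v∉blue b ]′ (meets Jf (from t b (at z∈x z∈b)))
      twing : ∀ {x} → Blue x → Twin c j g x → (g ~ f → x ~ f) → (x ~ f → g ~ f) → ⊥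
      twing q t _ _ with meets Jh (~-sym (to t ph (at (left Jg) (left Jh))))
      ... | inj₁ v∈x = v∉blue q v∈x
      ... | inj₂ w∈x with colw q w∈x
      ... | inj₁ refl = clash ph q
      ... | inj₂ refl with meets Jg (from t pe (at (left Je′) (left Je)))
      ... | inj₁ v∈e with colv pe v∈e
      ... | refl = u∉h (left Je)
      twing q t _ _ | inj₂ w∈x | inj₂ refl | inj₂ z∈e with ends-cover Je z∈e
      ... | inj₁ z≡u = z≢u z≡u
      ... | inj₂ refl = second noby

    -- Colour `f` blue and `g` red. A blue twin of `f` meets `e`, so it can only be `e′`, which
    -- misses `g`. A red twin of `g` meets `f`, so it can only be `e`, which meets `e′` while `g`
    -- does not.
    triangle-spare : ∀ {f e e′ g u v w} →
      White f → Red e → Blue e′ → Joins f u v → Joins e v w → Joins e′ u w →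
      (∀ {x} → Blue x → ¬ v ∈ᵉ x) → (∀ {x} → Red x → ¬ u ∈ᵉ x) →
      (∀ {x} → Red x → v ∈ᵉ x → x ≡ e) → (∀ {x} → Blue x → w ∈ᵉ x → x ≡ e′) →
      White g → v ∈ᵉ g → ¬ e′ ~ g → ⊥
    triangle-spare {f} {e} {e′} {g} wf pe pe′ Jf Je Je′ v∉blue u∉red red-v blue-w wg v∈g e′≁g =
      pairAdd M i≢j wf wg (λ { refl → e′≁g (at (left Je′) (left Jf)) })
        (λ ≁ → contradiction f~g ≁)
        (λ q t x _ → [ v∉blue q
                     , (λ w∈x → e′≁g (subst (_~ g) (blue-w q w∈x) (x f~g))) ]′ (meets Je (~-sym (to t pe (at (right Jf) (left Je))))))
        (λ ≁ → contradiction f~g ≁)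
        (λ q t x _ → [ u∉red q
                     , (λ v∈x → e′≁g (~-sym (from t pe′ (subst (_~ e′) (sym (red-v q v∈x)) (at (right Je) (right Je′)))))) ]′
                     (meets Jf (~-sym (x (~-sym f~g)))))
      where
      f~g : f ~ g
      f~g = at (right Jf) v∈g

  coloured? : ∀ (c : Colours) g {A : Set} → (c g ≡ nothing → A) → (∀ {k} → c g ≡ just k → A) → A
  coloured? c g w p with c g
  ... | nothing = w refl
  ... | just k  = p refl

  module _ {c : Colours} (M : Max c) {j i : Bool} (j≢i : j ≢ i) where
    open At M j≢i
    private
      i≢j : i ≢ j
      i≢j = j≢i ∘ sym

    -- First `f` takes the red of `e`, and `e` tries blue; if a blue twin `b` blocks this, `e` takes
    -- the blue of `b`, and `b` tries red. Only one obstruction survives: `b` is `e′` and its red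
    -- twin is `f`. Then `e` and `e′` meet the same coloured edges of `c`, so the edge splitting
    -- them is white.
    triangle : ∀ {f e e′ u v w} →
      White f → Red e → Blue e′ → Joins f u v → Joins e v w → Joins e′ u w →
      Twin c i f e → Twin c j f e′ → ⊥
    triangle {f} {e} {e′} {u} {v} {w} wf pe pe′ Jf Je Je′ t t′ =
      add A.swap-max i≢j A.swap-e (λ emp → emp f A.swap-f e~f) no-twin
      where
      module A = Swap M j≢i wf pe t
      e~f : e ~ f
      e~f = at (left Je) (right Jf)
      e~e′ : e ~ e′
      e~e′ = at (right Je) (right Je′)
      blue-u : ∀ {g} → Blue g → u ∈ᵉ g → e′ ≡ g
      blue-u q x with meets Je (to t q (at (left Jf) x))
      ... | inj₁ v∈g = ⊥-elim (only Jf wf q x v∈g)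
      ... | inj₂ w∈g = no-parallel Je′ x w∈g
      blue-w : ∀ {g} → Blue g → w ∈ᵉ g → e′ ≡ g
      blue-w q x with meets Jf (from t q (at (right Je) x))
      ... | inj₁ u∈g = no-parallel Je′ u∈g x
      ... | inj₂ v∈g = ⊥-elim (redblue Je pe q v∈g x)
      red-v : ∀ {g} → Red g → v ∈ᵉ g → e ≡ g
      red-v q x with meets Je′ (to t′ q (at (right Jf) x))
      ... | inj₁ u∈g = ⊥-elim (only Jf wf q u∈g x)
      ... | inj₂ w∈g = no-parallel Je x w∈g
      red-w : ∀ {g} → Red g → w ∈ᵉ g → e ≡ g
      red-w q x with meets Jf (from t′ q (at (right Je′) x))
      ... | inj₁ u∈g = ⊥-elim (bluered Je′ pe′ q u∈g x)
      ... | inj₂ v∈g = no-parallel Je v∈g x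
      red-e : ∀ {r} → Red r → r ~ e → e ≡ r
      red-e q x = [ red-v q , red-w q ]′ (meets Je (~-sym x))
      v∉e′ : ¬ v ∈ᵉ e′
      v∉e′ x = only Jf wf pe′ (left Je′) x
      u∉e : ¬ u ∈ᵉ e
      u∉e x = only Jf wf pe x (left Je)

      no-twin : ∀ {b} → A.d b ≡ just i → ¬ Twin A.d j e b
      no-twin {b} pb T with meets Jf (~-sym (to T A.swap-f e~f))
      ... | inj₂ v∈b = add B.swap-max j≢i B.swap-e (λ emp → emp e B.swap-f (at v∈b (left Je))) done
        where
        qb : Blue b
        qb = A.unswap-i pb
        module B = Swap A.swap-max i≢j A.swap-e pb T
        done : ∀ {r} → B.d r ≡ just j → ¬ Twin B.d i b r
        done pr T′ with A.unswap-j (B.unswap-i pr)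
        ... | inj₂ (qr , r≢e) = r≢e (sym (red-e qr (to T′ B.swap-f (at v∈b (left Je)))))
        ... | inj₁ refl with meets Je′ (~-sym (from T′ (B.swap-j (λ { refl → v∉e′ v∈b }) (A.swap-i pe′)) (at (left Jf) (left Je′))))
        ... | inj₁ u∈b = only Jf wf qb u∈b v∈b
        ... | inj₂ w∈b = redblue Je pe qb v∈b w∈b
      ... | inj₁ u∈b with blue-u (A.unswap-i pb) u∈b
      ... | refl = add B.swap-max j≢i B.swap-e (λ emp → emp e B.swap-f (~-sym e~e′)) done
        where
        module B = Swap A.swap-max i≢j A.swap-e pb T
        u∉red : ∀ {g} → Red g → ¬ u ∈ᵉ g
        u∉red q u∈g with meets Je (from T (A.swap-j (λ { refl → u∉e u∈g }) q) (at (left Je′) u∈g))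
        ... | inj₁ v∈g = only Jf wf q u∈g v∈g
        ... | inj₂ w∈g = bluered Je′ pe′ q u∈g w∈g
        done : ∀ {r} → B.d r ≡ just j → ¬ Twin B.d i e′ r
        done pr T′ with A.unswap-j (B.unswap-i pr)
        ... | inj₂ (qr , r≢e) = r≢e (sym (red-e qr (to T′ B.swap-f (~-sym e~e′))))
        ... | inj₁ refl = split-adjacent (λ { refl → clash pe pe′ }) e~e′ separate
          where
          v∉blue : ∀ {g} → Blue g → ¬ v ∈ᵉ g
          v∉blue q v∈g with meets Je′ (from T′ (B.swap-j (λ { refl → v∉e′ v∈g }) (A.swap-i q)) (at (right Jf) v∈g))
          ... | inj₁ u∈g = only Jf wf q u∈g v∈g
          ... | inj₂ w∈g = redblue Je pe q v∈g w∈g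
          separate : ∀ {g} → Splits g e e′ ⊎ Splits g e′ e → ⊥
          separate {g} s = coloured? c g (white s) (λ {k} q → coloured s q (bool-cover j≢i k))
            where
            white : Splits g e e′ ⊎ Splits g e′ e → White g → ⊥
            white (inj₁ (e~g , e′≁g)) wg with meets Je e~g
            ... | inj₂ w∈g = e′≁g (at (right Je′) w∈g)
            ... | inj₁ v∈g = triangle-spare M j≢i wf pe pe′ Jf Je Je′ v∉blue u∉red
                               (λ q x → sym (red-v q x)) (λ q x → sym (blue-w q x)) wg v∈g e′≁g
            white (inj₂ (e′~g , e≁g)) wg with meets Je′ e′~g
            ... | inj₂ w∈g = e≁g (at (right Je) w∈g)
            ... | inj₁ u∈g = triangle-spare M i≢j wf pe′ pe (flip Jf) Je′ Je u∉red v∉blue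
                               (λ q x → sym (blue-u q x)) (λ q x → sym (red-w q x)) wg u∈g e≁g
            coloured : Splits g e e′ ⊎ Splits g e′ e → ∀ {k} → c g ≡ just k → k ≡ j ⊎ k ≡ i → ⊥
            coloured (inj₁ (e~g , e′≁g)) q (inj₁ refl) = e′≁g (subst (e′ ~_) (red-e q (~-sym e~g)) (~-sym e~e′))
            coloured (inj₁ (e~g , e′≁g)) q (inj₂ refl) =
              [ v∉blue q , (λ w∈g → e′≁g (at (right Je′) w∈g)) ]′ (meets Je e~g)
            coloured (inj₂ (e′~g , e≁g)) q (inj₁ refl) =
              [ u∉red q , (λ w∈g → e≁g (at (right Je) w∈g)) ]′ (meets Je′ e′~g)
            coloured (inj₂ (e′~g , e≁g)) q (inj₂ refl) =
              [ (λ u∈g → e≁g (subst (e ~_) (blue-u q u∈g) e~e′)) , (λ w∈g → e≁g (at (right Je) w∈g)) ]′ (meets Je′ e′~g)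

-- Twins forming a star with the white edge, whose leaf carries a coloured edge.

module Stars {n m : ℕ} (G : Graph n m) (twin-free : EdgeTwinFree G) where
  open Incidence G
  open Colouring G
  open Moves G
  open Adjacent G twin-free

  module _ {c : Colours} (M : Max c) {j i : Bool} (j≢i : j ≢ i) where
    open At M j≢i
    private
      i≢j : i ≢ j
      i≢j = j≢i ∘ sym

    module Star {f e e′ : Fin m} {u v y w : Fin n}
      (wf : White f) (pe : Red e) (pe′ : Blue e′)
      (Jf : Joins f u v) (Je : Joins e u y) (Je′ : Joins e′ u w)
      (t : Twin c i f e) (t′ : Twin c j f e′) where

      -- Meeting `f`, such an edge meets `e` too, and not at `u`, where it would be parallel to `f`.
      -- With the next three: blue edges at `v` or `y` are `vy`, red edges at `v` or `w` are `vw`.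
      blue-v : ∀ {g} → Blue g → v ∈ᵉ g → y ∈ᵉ g
      blue-v q x = [ (λ u∈g → ⊥-elim (only Jf wf q u∈g x)) , id ]′ (meets Je (to t q (at (right Jf) x)))

      blue-y : ∀ {g} → Blue g → y ∈ᵉ g → v ∈ᵉ g
      blue-y q x = [ (λ u∈g → ⊥-elim (redblue Je pe q u∈g x)) , id ]′ (meets Jf (from t q (at (right Je) x)))

      red-v : ∀ {g} → Red g → v ∈ᵉ g → w ∈ᵉ g
      red-v q x = [ (λ u∈g → ⊥-elim (only Jf wf q u∈g x)) , id ]′ (meets Je′ (to t′ q (at (right Jf) x)))

      red-w : ∀ {g} → Red g → w ∈ᵉ g → v ∈ᵉ g
      red-w q x = [ (λ u∈g → ⊥-elim (bluered Je′ pe′ q u∈g x)) , id ]′ (meets Jf (from t′ q (at (right Je′) x)))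

      v≢y : v ≢ y
      v≢y refl = only Jf wf pe (left Je) (right Je)

      y≢w : y ≢ w
      y≢w refl = redblue Je pe pe′ (left Je′) (right Je′)

      e~f : e ~ f
      e~f = at (left Je) (left Jf)

      module Linked {h} (ph : Red h) (Jh : Joins h v w) where

        f~h : f ~ h
        f~h = at (right Jf) (left Jh)

        e′~h : e′ ~ h
        e′~h = at (right Je′) (right Jh)

        e′~f : e′ ~ f
        e′~f = at (left Je′) (left Jf)

        u∉h : ¬ u ∈ᵉ h
        u∉h u∈h = only Jf wf ph u∈h (left Jh)

        e≁h : ¬ e ~ h
        e≁h x with meets Je x
        ... | inj₁ u∈h = u∉h u∈h
        ... | inj₂ y∈h = [ v≢y ∘ sym , y≢w ]′ (ends-cover Jh y∈h)

        e≢h : e ≢ h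
        e≢h refl = u∉h (left Je)

        red-h : ∀ {g} → Red g → g ~ h → h ≡ g
        red-h q x with meets Jh (~-sym x)
        ... | inj₁ v∈g = no-parallel Jh v∈g (red-v q v∈g)
        ... | inj₂ w∈g = no-parallel Jh (red-w q w∈g) w∈g

        -- Once `h` is no longer red, the red edges meeting `e′` all pass through `u`; these are the
        -- blue edges at `u` that could then not be told from `e′`.
        Pendant : Fin m → Fin n → Set
        Pendant b s = Blue b × Joins b u s × b ≢ e′ × (∀ {g} → Red g → ¬ s ∈ᵉ g)

        -- h turns blue and f red.
        no-pendant : ∀ {r s′} → (∀ {b s} → ¬ Pendant b s) → Red r → Joins r u s′ →
          (∀ {q} → Blue q → w ∈ᵉ q → q ≢ e′ → s′ ∈ᵉ q) → (∀ {q} → Blue q → s′ ∈ᵉ q → w ∈ᵉ q) → ⊥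
        no-pendant {r} {s′} nopb pr Jr W S = flip-add
          (λ q r≢h T → r≢h (sym (red-h q (to T d-h f~h))))
          twin-h
          dom loc
          where
          open Flip wf ph f~h
          dr : d r ≡ just j
          dr = d-red (λ { refl → u∉h (left Jr) }) pr
          twin-h : ∀ {b} → Blue b → ¬ Twin d j h b
          -- `b` meets the red `f`, and therefore meets `e` at `u` or at `y`; but `h` misses `e`.
          twin-h {b} q T = e≁h (~-sym (from T (d-red e≢h pe) b~e))
            where
            b~e : b ~ e
            b~e with meets Jf (~-sym (to T d-f (~-sym f~h)))
            ... | inj₁ u∈b = at u∈b (left Je)
            ... | inj₂ v∈b = at (blue-v q v∈b) (right Je)
          dom : ∀ {b} → Blue b → b ~ h → ¬ Empty d j b
          dom {b} q x emp with meets Jh (~-sym x)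
          ... | inj₁ v∈b = emp _ d-f (at v∈b (right Jf))
          ... | inj₂ w∈b with same? b e′
          ... | inj₁ refl = emp _ d-f e′~f
          ... | inj₂ b≢e′ = emp _ dr (at (W q w∈b b≢e′) (right Jr))
          loc : ∀ {b b′} → Blue b → Blue b′ → Twin d j b b′ → b ~ h → b′ ~ h
          loc {b} {b′} q q′ T x with meets Jh (~-sym x)
          ... | inj₁ v∈b with meets Jf (~-sym (to T d-f (at v∈b (right Jf))))
          ... | inj₂ v∈b′ = at v∈b′ (left Jh)
          ... | inj₁ u∈b′ with meets Jr (~-sym (from T dr (at u∈b′ (left Jr))))
          ... | inj₁ u∈b = ⊥-elim (only Jf wf q u∈b v∈b)
          ... | inj₂ s∈b = ⊥-elim (redblue Jh ph q v∈b (S q s∈b))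
          loc {b} {b′} q q′ T x | inj₂ w∈b with same? b e′
          loc {b} {b′} q q′ T x | inj₂ w∈b | inj₁ refl with meets Jf (~-sym (to T d-f e′~f))
          ... | inj₂ v∈b′ = at v∈b′ (left Jh)
          ... | inj₁ u∈b′ with same? b′ e′ | opposite u∈b′
          ... | inj₁ refl | _ = e′~h
          -- Otherwise `b′` is a pendant: a red edge at `s` would be met by `e′`, whose only red
          -- edge away from `u` was `h`.
          ... | inj₂ b′≢e′ | s , Jb = decidable-stable (b′ ~? h) λ b′≁h →
            nopb (q′ , Jb , b′≢e′ , λ {g} pg s∈g →
              let g≢h = λ { refl → b′≁h (at (right Jb) s∈g) } in
              [ (λ u∈g → bluered Jb q′ pg u∈g s∈g)
              , (λ w∈g → g≢h (sym (red-h pg (at w∈g (right Jh))))) ]′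
              (meets Je′ (from T (d-red g≢h pg) (at (right Jb) s∈g))))
          loc {b} {b′} q q′ T x | inj₂ w∈b | inj₂ b≢e′ with meets Jr (~-sym (to T dr (at (W q w∈b b≢e′) (right Jr))))
          ... | inj₂ s∈b′ = at (S q′ s∈b′) (right Jh)
          ... | inj₁ u∈b′ with meets Jf (~-sym (from T d-f (at u∈b′ (left Jf))))
          ... | inj₁ u∈b = contradiction (sym (no-parallel Je′ u∈b w∈b)) b≢e′
          ... | inj₂ v∈b = ⊥-elim (redblue Jh ph q v∈b w∈b)

        -- e′ turns red, h blue and f red: the blue edge p, having no red edge at its
        -- other end, keeps the red edges at u apart from all others.
        pendant : ∀ {p s q} → Pendant p s → Blue q → v ∈ᵉ q ⊎ (w ∈ᵉ q × q ≢ e′) → ⊥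
        pendant {p} {s} {q} (pp , Jp , p≢e′ , s∉red) pq vw = flip₂-add
          (twin-fq vw)
          (λ x r≢h T → r≢h (sym (red-h x (to T d-h f~h))))
          (λ x r≢h T → r≢h (sym (red-h x (to T d-h e′~h))))
          twin-h
          (λ x r≢h r~e′ emp → emp _ dp (at (u∈ x r≢h r~e′) (left Jp)))
          (λ x r≢h x′ _ T r~e′ → [ (λ u∈r′ → at u∈r′ (left Je′)) , (λ s∈r′ → ⊥-elim (s∉red x′ s∈r′)) ]′
                                  (meets Jp (~-sym (to T dp (at (u∈ x r≢h r~e′) (left Jp))))))
          (λ x _ b~h emp → [ (λ v∈b → emp _ d-f (at v∈b (right Jf)))
                           , (λ w∈b → emp _ d-q (at w∈b (right Je′))) ]′ (meets Jh (~-sym b~h)))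
          locb
          where
          open Flip₂ wf ph pe′ f~h e′~h
          dp : d p ≡ just i
          dp = d-blue p≢e′ pp
          u∈ : ∀ {r} → Red r → r ≢ h → r ~ e′ → u ∈ᵉ r
          u∈ x r≢h r~e′ = [ id , (λ w∈r → contradiction (sym (red-h x (at w∈r (right Jh)))) r≢h) ]′ (meets Je′ (~-sym r~e′))
          -- Both `f` and `e′` are now red, and `q` meets exactly one of them.
          twin-fq : v ∈ᵉ q ⊎ (w ∈ᵉ q × q ≢ e′) → ¬ Twin d i f e′
          twin-fq (inj₁ v∈q) T =
            [ (λ u∈q → only Jf wf pq u∈q v∈q) , redblue Jh ph pq v∈q ]′
            (meets Je′ (to T (d-blue (λ { refl → only Jf wf pe′ (left Je′) v∈q }) pq) (at (right Jf) v∈q)))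
          twin-fq (inj₂ (w∈q , q≢e′)) T =
            [ (λ u∈q → q≢e′ (sym (no-parallel Je′ u∈q w∈q))) , (λ v∈q → redblue Jh ph pq v∈q w∈q) ]′
            (meets Jf (from T (d-blue q≢e′ pq) (at (right Je′) w∈q)))
          twin-h : ∀ {b} → Blue b → b ≢ e′ → ¬ Twin d j h b
          twin-h {b} x b≢e′ T with meets Jf (~-sym (to T d-f (~-sym f~h))) | meets Je′ (~-sym (to T d-q (~-sym e′~h)))
          ... | inj₂ v∈b | inj₂ w∈b = redblue Jh ph x v∈b w∈b
          ... | inj₂ v∈b | inj₁ u∈b = only Jf wf x u∈b v∈b
          ... | inj₁ u∈b | _ = e≁h (~-sym (from T (d-red e≢h pe) (at u∈b (left Je))))
          locb : ∀ {b b′} → Blue b → b ≢ e′ → Blue b′ → b′ ≢ e′ → Twin d j b b′ → b ~ h → b′ ~ h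
          locb {b} {b′} x b≢e′ x′ _ T b~h with meets Jh (~-sym b~h)
          ... | inj₁ v∈b with meets Jf (~-sym (to T d-f (at v∈b (right Jf))))
          ... | inj₂ v∈b′ = at v∈b′ (left Jh)
          ... | inj₁ u∈b′ with meets Je′ (~-sym (from T d-q (at u∈b′ (left Je′))))
          ... | inj₁ u∈b = ⊥-elim (only Jf wf x u∈b v∈b)
          ... | inj₂ w∈b = ⊥-elim (redblue Jh ph x v∈b w∈b)
          locb {b} {b′} x b≢e′ x′ _ T b~h | inj₂ w∈b with meets Je′ (~-sym (to T d-q (at w∈b (right Je′))))
          ... | inj₂ w∈b′ = at w∈b′ (right Jh)
          ... | inj₁ u∈b′ with meets Jf (~-sym (from T d-f (at u∈b′ (left Jf))))
          ... | inj₁ u∈b = contradiction (sym (no-parallel Je′ u∈b w∈b)) b≢e′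
          ... | inj₂ v∈b = ⊥-elim (redblue Jh ph x v∈b w∈b)

        -- Without such a `q`, the coloured edges at `v` and `w` are just `h` and `e′`, so `f` and
        -- `e′` agree on coloured edges. The edge splitting them is white, and `spare` applies.
        bare-triangle : ∀ {p s} → Pendant p s →
          (∀ {q} → Blue q → ¬ (v ∈ᵉ q ⊎ (w ∈ᵉ q × q ≢ e′))) → ⊥
        bare-triangle {p} (pp , Jp , p≢e′ , _) none =
          split-adjacent (λ { refl → wclash wf pe′ }) (~-sym e′~f) λ {g} s →
            coloured? c g (white s) λ q → coloured s q
          where
          colv : ∀ {x k} → c x ≡ just k → v ∈ᵉ x → x ≡ h
          colv {x} {k} q v∈x with bool-cover j≢i k
          ... | inj₁ refl = sym (red-h q (at v∈x (left Jh)))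
          ... | inj₂ refl = ⊥-elim (none q (inj₁ v∈x))
          colw : ∀ {x k} → c x ≡ just k → w ∈ᵉ x → x ≡ h ⊎ x ≡ e′
          colw {x} {k} q w∈x with bool-cover j≢i k
          ... | inj₁ refl = inj₁ (sym (red-h q (at w∈x (right Jh))))
          ... | inj₂ refl = [ inj₂ , (λ x≢e′ → ⊥-elim (none q (inj₂ (w∈x , x≢e′)))) ]′ (same? x e′)
          y∉blue : ∀ {x} → Blue x → ¬ y ∈ᵉ x
          y∉blue q y∈x = none q (inj₁ (blue-y q y∈x))
          coloured : ∀ {g} → Splits g f e′ ⊎ Splits g e′ f → ∀ {k} → c g ≡ just k → ⊥
          coloured (inj₁ (f~g , e′≁g)) q with meets Jf f~g
          ... | inj₁ u∈g = e′≁g (at (left Je′) u∈g)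
          ... | inj₂ v∈g = e′≁g (subst (e′ ~_) (sym (colv q v∈g)) e′~h)
          coloured (inj₂ (e′~g , f≁g)) q with meets Je′ e′~g
          ... | inj₁ u∈g = f≁g (at (left Jf) u∈g)
          ... | inj₂ w∈g = [ (λ { refl → f≁g f~h }) , (λ { refl → f≁g (~-sym e′~f) }) ]′ (colw q w∈g)
          white : ∀ {g} → Splits g f e′ ⊎ Splits g e′ f → White g → ⊥
          white (inj₁ (f~g , e′≁g)) wg with meets Jf f~g
          ... | inj₁ u∈g = e′≁g (at (left Je′) u∈g)
          ... | inj₂ v∈g with opposite v∈g
          ... | z , Jg = spare M j≢i wf pe pe′ ph pp Jf Je Je′ Jh (left Jp) p≢e′ colv colw y∉blue wg Jg
                  (λ { refl → e′≁g (at (left Je′) (right Jg)) }) (λ { refl → e′≁g (at (right Je′) (right Jg)) })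
          white {g} (inj₂ (e′~g , f≁g)) wg with meets Je′ e′~g
          ... | inj₁ u∈g = f≁g (at (left Jf) u∈g)
          ... | inj₂ w∈g with opposite w∈g
          -- An edge at `w` is treated like one at `v` once `f` and `e′` have traded roles.
          ... | z , Jg = spare S.swap-max j≢i S.swap-e (S.swap-i pe) S.swap-f (S.swap-i ph)
                  (S.swap-j p≢e′ pp) Je′ Je Jf (flip Jh) (left Jp) (λ { refl → wclash wf pp }) colw′ colv′ y∉blue′
                  (S.swap-white (λ { refl → f≁g ~-refl }) wg) Jg
                  (λ { refl → f≁g (at (left Jf) (right Jg)) }) (λ { refl → f≁g (at (right Jf) (right Jg)) })
            where
            module S = Swap M i≢j wf pe′ t′
            colw′ : ∀ {x k} → S.d x ≡ just k → w ∈ᵉ x → x ≡ h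
            colw′ q w∈x with S.unswap q
            ... | inj₁ (refl , _) = ⊥-elim ([ (λ { refl → apart Je′ refl }) , (λ { refl → apart Jh refl }) ]′ (ends-cover Jf w∈x))
            ... | inj₂ (q′ , x≢e′ , _) = [ id , (λ x≡e′ → contradiction x≡e′ x≢e′) ]′ (colw q′ w∈x)
            colv′ : ∀ {x k} → S.d x ≡ just k → v ∈ᵉ x → x ≡ h ⊎ x ≡ f
            colv′ q v∈x with S.unswap q
            ... | inj₁ (x≡f , _) = inj₂ x≡f
            ... | inj₂ (q′ , _) = inj₁ (colv q′ v∈x)
            y∉blue′ : ∀ {x} → S.d x ≡ just i → ¬ y ∈ᵉ x
            y∉blue′ q y∈x with S.unswap q
            ... | inj₁ (refl , _) = [ (λ { refl → apart Je refl }) , v≢y ∘ sym ]′ (ends-cover Jf y∈x)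
            ... | inj₂ (q′ , _) = y∉blue q′ y∈x

        -- If a pendant exists, the existence of `q` decides between `pendant` and `bare-triangle`.
        -- If none exists, `e′` gives its blue to `f` and tries red; a red twin of it meets `f`, and
        -- either passes through `u`, giving the `r` of `no-pendant`, or is `h`.
        linked : ⊥
        linked = em {Σ _ λ b → Σ _ λ s → Pendant b s}
          (λ (_ , _ , P) → em {Σ _ λ q → Blue q × (v ∈ᵉ q ⊎ (w ∈ᵉ q × q ≢ e′))}
            (λ (_ , pq , x) → pendant P pq x)
            (λ none → bare-triangle P λ pq x → none (_ , pq , x)))
          (λ nopb → add S.swap-max j≢i S.swap-e (λ emp → emp f S.swap-f e′~f) (no-twin λ P → nopb (_ , _ , P)))
          where
          module S = Swap M i≢j wf pe′ t′
          no-twin : (∀ {b s} → ¬ Pendant b s) → ∀ {r} → S.d r ≡ just j → ¬ Twin S.d i e′ r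
          no-twin nopb {r} pr T with meets Jf (~-sym (to T S.swap-f e′~f))
          ... | inj₁ u∈r with opposite u∈r
          ... | s′ , Jr = no-pendant nopb (S.unswap-i pr) Jr
                (λ pq w∈q q≢e′ → [ (λ u∈q → contradiction (sym (no-parallel Je′ u∈q w∈q)) q≢e′) , id ]′
                                  (meets Jr (to T (S.swap-j q≢e′ pq) (at (right Je′) w∈q))))
                (λ {q} pq s∈q → [ (λ { refl → right Je′ })
                            , (λ q≢e′ → [ (λ u∈q → ⊥-elim (redblue Jr (S.unswap-i pr) pq u∈q s∈q)) , id ]′
                                         (meets Je′ (from T (S.swap-j q≢e′ pq) (at (right Jr) s∈q)))) ]′ (same? q e′))
          no-twin nopb {r} pr T | inj₂ v∈r with red-h (S.unswap-i pr) (at v∈r (left Jh))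
          -- With `h` a twin of `e′`, no blue edge is at `v`, and only `e′` is at `u`. Starting
          -- again from `c`, `e` gives its red to `f` and tries blue: its twin could only be `e′`,
          -- which meets `h` while `e` does not.
          ... | refl = add A.swap-max i≢j A.swap-e (λ emp → emp f A.swap-f e~f) no-twin′
            where
            module A = Swap M j≢i wf pe t
            blue-u : ∀ {g} → Blue g → u ∈ᵉ g → e′ ≡ g
            blue-u {g} q u∈g = [ sym , (λ g≢e′ →
              [ (λ v∈g → ⊥-elim (only Jf wf q u∈g v∈g)) , (λ w∈g → no-parallel Je′ u∈g w∈g) ]′
              (meets Jh (to T (S.swap-j g≢e′ q) (at (left Je′) u∈g)))) ]′ (same? g e′)
            v∉blue : ∀ {g} → Blue g → ¬ v ∈ᵉ g
            v∉blue q v∈g =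
              [ (λ u∈g → only Jf wf q u∈g v∈g) , redblue Jh ph q v∈g ]′
              (meets Je′ (from T (S.swap-j (λ { refl → only Jf wf pe′ (left Je′) v∈g }) q) (at (left Jh) v∈g)))
            no-twin′ : ∀ {b} → A.d b ≡ just i → ¬ Twin A.d j e b
            no-twin′ pb T′ with meets Jf (~-sym (to T′ A.swap-f e~f))
            ... | inj₂ v∈b = v∉blue (A.unswap-i pb) v∈b
            ... | inj₁ u∈b with blue-u (A.unswap-i pb) u∈b
            ... | refl = e≁h (from T′ (A.swap-j (e≢h ∘ sym) ph) e′~h)

-- The remaining star, and twins that miss the white edge.

module Cases {n m : ℕ} (G : Graph n m) (twin-free : EdgeTwinFree G) where
  open Incidence G
  open Colouring G
  open Moves G
  open Adjacent G twin-free
  open Stars G twin-free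

  -- The open-neighbourhood half. As `_~_` is reflexive, `e` and `f` would themselves count as
  -- splitting, so `g` is kept distinct from them.
  split-distant : ∀ {e f} → e ≢ f → ¬ e ~ f →
    (∀ {g} → g ≢ e → g ≢ f → Splits g e f ⊎ Splits g f e → ⊥) → ⊥
  split-distant {e} {f} e≢f e≁f none = twin-free e f
    (e≢f , inj₁ λ g → mk⇔ (half e≁f (λ x y z → none y x (inj₁ z))) (half (e≁f ∘ ~-sym) (λ x y z → none x y (inj₂ z))))
    where
    half : ∀ {e f g} → ¬ e ~ f → (g ≢ f → g ≢ e → ¬ Splits g e f) → InN G e g → InN G f g
    half {e} {f} {g} e≁f none (g≢e , _ , p , q) with f ~? g
    ... | yes (at r s) = g≢f , _ , r , s
      where
      g≢f : g ≢ f
      g≢f refl = e≁f (at p q)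
    ... | no f≁g = contradiction (at p q , f≁g) (none (λ { refl → e≁f (at p q) }) g≢e)

  module _ {c : Colours} (M : Max c) {j i : Bool} (j≢i : j ≢ i) where
    open At M j≢i
    private
      i≢j : i ≢ j
      i≢j = j≢i ∘ sym

    -- A coloured edge at the leaf `v` is `vw` or `vy`, and `linked` applies, in the second case
    -- with colours exchanged. If `v` is bare, an edge splitting `f` and `e` hangs at `v` or `y`.
    star : ∀ {f e e′ u v y w} → White f → Red e → Blue e′ →
      Joins f u v → Joins e u y → Joins e′ u w → Twin c i f e → Twin c j f e′ → ⊥
    star {f} {e} {e′} {u} {v} {y} {w} wf pe pe′ Jf Je Je′ t t′ =
      em {Σ _ λ h → Red h × v ∈ᵉ h}
        (λ (h , ph , v∈h) → Linked.linked ph (joins v∈h (red-v ph v∈h) v≢w))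
        λ nored → em {Σ _ λ b → Blue b × v ∈ᵉ b}
          (λ (b , pb , v∈b) → Star.Linked.linked M i≢j wf pe′ pe Jf Je′ Je t′ t pb (joins v∈b (blue-v pb v∈b) v≢y))
          λ noblue → bare-v (bare nored noblue)
      where
      open Star M j≢i wf pe pe′ Jf Je Je′ t t′
      v≢w : v ≢ w
      v≢w refl = only Jf wf pe′ (left Je′) (right Je′)
      bare : ¬ (Σ _ λ h → Red h × v ∈ᵉ h) → ¬ (Σ _ λ b → Blue b × v ∈ᵉ b) → Bare v
      bare nored noblue {x} {k} v∈x q with bool-cover j≢i k
      ... | inj₁ refl = nored (x , q , v∈x)
      ... | inj₂ refl = noblue (x , q , v∈x)
      bare-v : Bare v → ⊥
      bare-v bare = split-adjacent (λ { refl → wclash wf pe }) (~-sym e~f) splits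
        where
        module A = Swap M j≢i wf pe t
        module B = At A.swap-max j≢i
        splits : ∀ {g} → Splits g f e ⊎ Splits g e f → ⊥
        splits {g} (inj₁ (f~g , e≁g)) with meets Jf f~g
        ... | inj₁ u∈g = e≁g (at (left Je) u∈g)
        ... | inj₂ v∈g with opposite v∈g
        ... | z , Jg = coloured? c g
          (λ wg → joint M j≢i wf wg Jf (flip Jg) (λ { refl → e≁g (at (left Je) (right Jg)) }) bare)
          (bare v∈g)
        splits {g} (inj₂ (e~g , f≁g)) with meets Je e~g
        ... | inj₁ u∈g = f≁g (at (left Jf) u∈g)
        ... | inj₂ y∈g with opposite y∈g
        -- After `f` and `e` are exchanged, `y` is the leaf in question. If it is bare, `joint`
        -- applies there; otherwise `e` tries blue, and a twin `b` gives a new star at `u` whose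
        -- leaf `y` is not bare.
        ... | z , Jg = em {Σ _ λ h → Σ _ λ k → A.d h ≡ just k × y ∈ᵉ h}
          (λ (h , k , ph , y∈h) → add A.swap-max i≢j A.swap-e (λ emp → emp f A.swap-f e~f) (no-twin ph y∈h))
          (λ none → coloured? A.d g
            (λ wg → joint A.swap-max j≢i A.swap-e wg Je (flip Jg) (λ { refl → f≁g (at (left Jf) (right Jg)) })
                      (λ y∈x q → none (_ , _ , q , y∈x)))
            (λ q → none (_ , _ , q , y∈g)))
          where
          no-twin : ∀ {h k} → A.d h ≡ just k → y ∈ᵉ h → ∀ {b} → A.d b ≡ just i → ¬ Twin A.d j e b
          no-twin {h} {k} ph y∈h pb T with meets Jf (~-sym (to T A.swap-f e~f))
          ... | inj₂ v∈b = bare v∈b (A.unswap-i pb)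
          ... | inj₁ u∈b with opposite u∈b
          ... | s , Jb with bool-cover j≢i k
          ... | inj₁ refl = Star.Linked.linked A.swap-max j≢i A.swap-e A.swap-f pb Je Jf Jb
                  (restrict A.unswap-i (Twin-sym t)) T ph
                  (joins y∈h (Star.red-v A.swap-max j≢i A.swap-e A.swap-f pb Je Jf Jb
                               (restrict A.unswap-i (Twin-sym t)) T ph y∈h)
                    (λ { refl → B.only Je A.swap-e pb (left Jb) (right Jb) }))
          ... | inj₂ refl = bare (Star.blue-v A.swap-max j≢i A.swap-e A.swap-f pb Je Jf Jb
                               (restrict A.unswap-i (Twin-sym t)) T ph y∈h) (A.unswap-i ph)

    -- Vacuous when `f` meets no blue edge; otherwise a red twin of `f` that misses `f` serves as
    -- `e` for every `b`.
    Guarded : Fin m → Set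
    Guarded f = ∀ {b} → Blue b → f ~ b → Σ (Fin m) λ e → Red e × b ~ e × ¬ f ~ e

    module Distant {f q : Fin m} (wf : White f) (pq : Blue q) (f≁q : ¬ f ~ q) (t : Twin c j f q) (guarded : Guarded f) where

      -- Such a `b` would join an end of `f` to an end of `q`. Its guard would meet `f` or `q`
      -- there, hence `f` in either case by the twin relation.
      apart-blue : ∀ {b} → Blue b → f ~ b → ¬ q ~ b
      apart-blue pb (at u∈f u∈b) (at x∈q x∈b) with guarded pb (at u∈f u∈b)
      ... | e , pe , b~e , f≁e with meets (joins u∈b x∈b λ { refl → f≁q (at u∈f x∈q) }) b~e
      ... | inj₁ u∈e = f≁e (at u∈f u∈e)
      ... | inj₂ x∈e = f≁e (from t pe (at x∈q x∈e))

      -- A red edge met by `f` is met by `q` too, so one of its ends lies on `f` and the other on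
      -- `q`.
      side : ∀ {a b} → Red a → f ~ a → b ~ a → f ~ b ⊎ q ~ b
      side pa (at u∈f u∈a) b~a with to t pa (at u∈f u∈a)
      ... | at x∈q x∈a with meets (joins u∈a x∈a λ { refl → f≁q (at u∈f x∈q) }) (~-sym b~a)
      ... | inj₁ u∈b = inj₁ (at u∈f u∈b)
      ... | inj₂ x∈b = inj₂ (at x∈q x∈b)

      near : ∀ {a r} → Red a → f ~ a → Red r → r ~ a → f ~ r
      near pa f~a pr r~a = [ id , from t pr ]′ (side pa f~a r~a)

      Far : Set
      Far = ∀ {g} → Blue g → g ≢ q → q ~ g → Σ (Fin m) λ e → Red e × ¬ f ~ e × g ~ e ×
              (∀ {b} → Blue b → b ≢ q → b ~ e → q ~ b)

      module S = Swap M i≢j wf pq t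

      -- Exchange `f` and `q` and let `q` try red. Either `q` then meets no blue edge and `Far` is
      -- vacuous, or the red twin blocking `q` is the required `e`, the same for all `g`.
      far : (Far → ⊥) → ⊥
      far k = em {Empty S.d i q}
        (λ emp → k λ pg g≢q q~g → ⊥-elim (emp _ (S.swap-j g≢q pg) q~g))
        λ nonempty → add S.swap-max j≢i S.swap-e nonempty λ {e} pe T →
          k λ pg g≢q q~g → e , S.unswap-i pe , (λ f~e → f≁q (~-sym (from T S.swap-f (~-sym f~e))))
            , ~-sym (to T (S.swap-j g≢q pg) q~g)
            , λ pb b≢q b~e → from T (S.swap-j b≢q pb) (~-sym b~e)

      -- a turns blue and f red.
      two-red-far : ∀ {a h} → Far → Red a → Red h → a ≢ h → f ~ a → f ~ h → ⊥
      two-red-far {a} {h} far pa ph a≢h f~a@(at {u} u∈f u∈a) f~h@(at {uh} uh∈f uh∈h)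
        with to t pa f~a | to t ph f~h
      ... | q~a@(at {x} x∈q x∈a) | q~h@(at {xh} xh∈q xh∈h) with opposite u∈f | opposite x∈q
      ... | v , Jf | y , Jq = flip-add
          (λ pr r≢a T → f≁q (from T (d-blue pq) (~-sym (to t pr (near pa f~a pr (to T d-h f~a))))))
          twin-a dom loc
        where
        open Flip wf pa f~a
        dh : d h ≡ just j
        dh = d-red (a≢h ∘ sym) ph
        Ja : Joins a u x
        Ja = joins u∈a x∈a λ { refl → f≁q (at u∈f x∈q) }
        Jh : Joins h uh xh
        Jh = joins uh∈h xh∈h λ { refl → f≁q (at uh∈f xh∈q) }
        distant : ∀ {e} → Red e → ¬ f ~ e → d e ≡ just j
        distant pe f≁e = d-red (λ { refl → f≁e f~a }) pe
        twin-a : ∀ {b} → Blue b → ¬ Twin d j a b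
        twin-a pb T with guarded pb (~-sym (to T d-f (~-sym f~a)))
        ... | e , pe , b~e , f≁e = f≁e (near pa f~a pe (~-sym (from T (distant pe f≁e) b~e)))
        dom : ∀ {b} → Blue b → b ~ a → ¬ Empty d j b
        dom {b} pb b~a emp with meets Ja (~-sym b~a)
        ... | inj₁ u∈b = emp _ d-f (at u∈b u∈f)
        ... | inj₂ x∈b with same? b q
        ... | inj₁ refl = emp _ dh q~h
        ... | inj₂ b≢q with far pb b≢q (at x∈q x∈b)
        ... | e , pe , f≁e , b~e , _ = emp _ (distant pe f≁e) b~e
        loc : ∀ {b b′} → Blue b → Blue b′ → Twin d j b b′ → b ~ a → b′ ~ a
        loc {b} {b′} pb pb′ T b~a with meets Ja (~-sym b~a)
        loc {b} {b′} pb pb′ T b~a | inj₁ u∈b with meets Jf (~-sym (to T d-f (at u∈b u∈f)))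
        ... | inj₁ u∈b′ = at u∈b′ u∈a
        -- `b` and `b′` meet `f` at different ends. Whichever end `h` uses, it meets one of them,
        -- hence the other, and by `apart-blue` not on `q`.
        ... | inj₂ v∈b′ with ends-cover Jf uh∈f
        ... | inj₁ refl = [ (λ u∈b′ → at u∈b′ u∈a)
                          , (λ xh∈b′ → ⊥-elim (apart-blue pb′ (at (right Jf) v∈b′) (at xh∈q xh∈b′))) ]′
                          (meets Jh (~-sym (to T dh (at u∈b uh∈h))))
        ... | inj₂ refl = ⊥-elim ([ only Jf wf pb u∈b , (λ xh∈b → apart-blue pb (at u∈f u∈b) (at xh∈q xh∈b)) ]′
                          (meets Jh (~-sym (from T dh (at v∈b′ uh∈h)))))
        loc {b} {b′} pb pb′ T b~a | inj₂ x∈b with same? b q | same? b′ q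
        ... | _ | inj₁ refl = q~a
        ... | inj₁ refl | inj₂ b′≢q with meets Jh (~-sym (to T dh q~h))
        ... | inj₁ uh∈b′ = ⊥-elim (f≁q (~-sym (from T d-f (at uh∈b′ uh∈f))))
        ... | inj₂ xh∈b′ with far pb′ b′≢q (at xh∈q xh∈b′)
        ... | e , pe , f≁e , b′~e , _ = ⊥-elim (f≁e (from t pe (from T (distant pe f≁e) b′~e)))
        loc {b} {b′} pb pb′ T b~a | inj₂ x∈b | inj₂ b≢q | inj₂ b′≢q with far pb b≢q (at x∈q x∈b)
        -- `b′` meets the far edge of `b`, hence `q`; now `h` decides between the ends of `q` as it
        -- did for `f`.
        ... | e , pe , f≁e , b~e , close with close pb′ b′≢q (to T (distant pe f≁e) b~e)
        ... | q~b′ with meets Jq q~b′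
        ... | inj₁ x∈b′ = at x∈b′ x∈a
        ... | inj₂ y∈b′ with ends-cover Jq xh∈q
        ... | inj₁ refl = [ (λ uh∈b′ → ⊥-elim (apart-blue pb′ (at uh∈f uh∈b′) q~b′)) , (λ x∈b′ → at x∈b′ x∈a) ]′
                          (meets Jh (~-sym (to T dh (at x∈b xh∈h))))
        ... | inj₂ refl = ⊥-elim ([ (λ uh∈b → apart-blue pb (at uh∈f uh∈b) (at x∈q x∈b))
                                  , (λ y∈b → b≢q (sym (no-parallel Jq x∈b y∈b))) ]′
                          (meets Jh (~-sym (from T dh (at y∈b′ xh∈h)))))

      two-red : ∀ {a h} → Red a → Red h → a ≢ h → f ~ a → f ~ h → ⊥
      two-red pa ph a≢h f~a f~h = far λ F → two-red-far F pa ph a≢h f~a f~h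

      module OneRed {a} (pa : Red a) (f~a : f ~ a) (uniq : ∀ {r} → Red r → f ~ r → r ≡ a) where

        q~a : q ~ a
        q~a = to t pa f~a

        -- a turns blue, q and f red.
        rotate : (∀ {b b′} → Blue b → Blue b′ → f ~ b → f ~ b′ → b ≡ b′) →
          (∀ {b b′} → Blue b → Blue b′ → b ≢ q → b′ ≢ q → q ~ b → q ~ b′ → b ≡ b′) →
          (Σ (Fin m) λ b → Blue b × (f ~ b ⊎ (b ≢ q × q ~ b))) → ⊥
        rotate uf uq (x , px , some) = flip₂-add
          (twin-fq some)
          (λ pr r≢a T → r≢a (uniq pr (near pa f~a pr (to T d-h f~a))))
          (λ pr r≢a T → r≢a (uniq pr (near pa f~a pr (to T d-h q~a))))
          (λ pb b≢q T → apart-blue pb (~-sym (to T d-f (~-sym f~a))) (~-sym (to T d-q (~-sym q~a))))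
          (λ pr r≢a r~q emp → r≢a (uniq pr (from t pr (~-sym r~q))))
          (λ pr r≢a _ _ _ r~q → contradiction (uniq pr (from t pr (~-sym r~q))) r≢a)
          (λ pb b≢q b~a emp → [ (λ f~b → emp _ d-f (~-sym f~b)) , (λ q~b → emp _ d-q (~-sym q~b)) ]′ (side pa f~a b~a))
          (λ {b} pb b≢q pb′ b′≢q T b~a →
            [ (λ f~b → subst (_~ a) (uf pb pb′ f~b (~-sym (to T d-f (~-sym f~b)))) b~a)
            , (λ q~b → subst (_~ a) (uq pb pb′ b≢q b′≢q q~b (~-sym (to T d-q (~-sym q~b)))) b~a) ]′ (side pa f~a b~a))
          where
          open Flip₂ wf pa pq f~a q~a
          twin-fq : f ~ x ⊎ (x ≢ q × q ~ x) → ¬ Twin d i f q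
          twin-fq (inj₁ f~x) T = apart-blue px f~x (to T (d-blue (λ { refl → f≁q f~x }) px) f~x)
          twin-fq (inj₂ (x≢q , q~x)) T = apart-blue px (from T (d-blue x≢q px) q~x) q~x

        -- Here f, a, q form a path whose end edges are open twins up to white edges.
        isolated-path : (∀ {b} → Blue b → ¬ (f ~ b ⊎ (b ≢ q × q ~ b))) → ⊥
        isolated-path none = split-distant (λ { refl → f≁q ~-refl }) f≁q λ {g} g≢f g≢q s →
          coloured? c g (white g≢f s) (λ {k} p → coloured g≢q s p (bool-cover j≢i k))
          where
          coloured : ∀ {g} → g ≢ q → Splits g f q ⊎ Splits g q f → ∀ {k} → c g ≡ just k → k ≡ j ⊎ k ≡ i → ⊥
          coloured _   (inj₁ (f~g , q≁g)) p (inj₁ refl) = q≁g (to t p f~g)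
          coloured _   (inj₁ (f~g , q≁g)) p (inj₂ refl) = none p (inj₁ f~g)
          coloured _   (inj₂ (q~g , f≁g)) p (inj₁ refl) = f≁g (from t p q~g)
          coloured g≢q (inj₂ (q~g , f≁g)) p (inj₂ refl) = none p (inj₂ (g≢q , q~g))
          blue-a : ∀ {b} → Blue b → b ~ a → b ≡ q
          blue-a {b} pb b~a with side pa f~a b~a
          ... | inj₁ f~b = ⊥-elim (none pb (inj₁ f~b))
          ... | inj₂ q~b = [ id , (λ b≢q → ⊥-elim (none pb (inj₂ (b≢q , q~b)))) ]′ (same? b q)
          white : ∀ {g} → g ≢ f → Splits g f q ⊎ Splits g q f → White g → ⊥
          -- `f` turns blue and `g` red: a blue twin of `f` must meet `a`, so it is `q`, and `g`
          -- tells these two apart.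
          white {g} g≢f s wg = pairAdd M i≢j wf wg (g≢f ∘ sym)
            (λ _ emp → emp a pa f~a)
            twin-f
            (λ g≁f emp → [ (λ (f~g , _) → g≁f f~g) , (λ (q~g , _) → emp q pq (~-sym q~g)) ]′ s)
            (twin-g s)
            where
            twin-f : ∀ {b} → Blue b → Twin c j f b → (f ~ g → b ~ g) → (b ~ g → f ~ g) → ⊥
            twin-f pb T x y with blue-a pb (to T pa f~a)
            ... | refl = [ (λ (f~g , q≁g) → q≁g (x f~g)) , (λ (q~g , f≁g) → f≁g (y q~g)) ]′ s
            twin-g : Splits g f q ⊎ Splits g q f → ∀ {r} → Red r → Twin c i g r → (g ~ f → r ~ f) → (r ~ f → g ~ f) → ⊥
            twin-g (inj₁ (f~g , q≁g)) pr T x _ with uniq pr (~-sym (x (~-sym f~g)))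
            ... | refl = q≁g (~-sym (from T pq (~-sym q~a)))
            twin-g (inj₂ (q~g , f≁g)) pr T _ y = f≁g (~-sym (y (~-sym (from t pr (~-sym (to T pq (~-sym q~g)))))))

  module _ {c : Colours} (M : Max c) {j i : Bool} (j≢i : j ≢ i) where
    open At M j≢i
    private
      i≢j : i ≢ j
      i≢j = j≢i ∘ sym

    -- If `f` meets two red edges or two blue ones, or `q` meets two blue ones besides itself,
    -- `two-red` applies after a change of colours or a swap if need be, unless `f` meets no blue
    -- edge to begin with. Otherwise `rotate` handles the presence of a further blue edge and
    -- `isolated-path` its absence.
    distant : ∀ {f q} → White f → Blue q → ¬ f ~ q → Twin c j f q →
      Empty c i f ⊎ (Σ (Fin m) λ e → Red e × ¬ f ~ e × Twin c i f e) → ⊥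
    distant {f} {q} wf pq f≁q t other = dominated (isGood M i≢j) pq λ a pa q~a →
      let f~a = from t pa q~a in
      em {Σ _ λ h → Red h × a ≢ h × f ~ h}
        (λ (h , ph , a≢h , f~h) → two-red pa ph a≢h f~a f~h)
        λ one → let open OneRed pa f~a (λ {r} pr f~r → decidable-stable (r ≟ a) λ r≢a → one (r , pr , r≢a ∘ sym , f~r)) in
      em {Σ _ λ b → Σ _ λ b′ → Blue b × Blue b′ × b ≢ b′ × f ~ b × f ~ b′}
        (λ (b , b′ , pb , pb′ , b≢b′ , f~b , f~b′) → two-blue other pb pb′ b≢b′ f~b f~b′)
        λ uf → em {Σ _ λ b → Σ _ λ b′ → Blue b × Blue b′ × b ≢ b′ × b ≢ q × b′ ≢ q × q ~ b × q ~ b′}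
        (λ (b , b′ , pb , pb′ , b≢b′ , b≢q , b′≢q , q~b , q~b′) → two-blue-q pb pb′ b≢b′ b≢q b′≢q q~b q~b′)
        λ uq → em {Σ _ λ b → Blue b × (f ~ b ⊎ (b ≢ q × q ~ b))}
        (rotate
          (λ {b} {b′} pb pb′ f~b f~b′ → decidable-stable (b ≟ b′) λ b≢b′ → uf (b , b′ , pb , pb′ , b≢b′ , f~b , f~b′))
          (λ {b} {b′} pb pb′ b≢q b′≢q q~b q~b′ → decidable-stable (b ≟ b′) λ b≢b′ →
            uq (b , b′ , pb , pb′ , b≢b′ , b≢q , b′≢q , q~b , q~b′)))
        λ none → isolated-path λ pb x → none (_ , pb , x)
      where
      guard : Empty c i f ⊎ (Σ (Fin m) λ e → Red e × ¬ f ~ e × Twin c i f e) → Guarded M j≢i f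
      guard (inj₁ emp) pb f~b = ⊥-elim (emp _ pb f~b)
      guard (inj₂ (e , pe , f≁e , t′)) pb f~b = e , pe , ~-sym (to t′ pb f~b) , f≁e
      open Distant M j≢i wf pq f≁q t (guard other)
      two-blue : Empty c i f ⊎ (Σ (Fin m) λ e → Red e × ¬ f ~ e × Twin c i f e) →
        ∀ {b b′} → Blue b → Blue b′ → b ≢ b′ → f ~ b → f ~ b′ → ⊥
      two-blue (inj₁ emp) pb _ _ f~b _ = emp _ pb f~b
      -- With the colours exchanged, `e` plays the part of `q`, and `q` is the guard.
      two-blue (inj₂ (e , pe , f≁e , t′)) = Distant.two-red M i≢j wf pe f≁e t′ (λ pr f~r → q , pq , ~-sym (to t pr f~r) , f≁q)
      two-blue-q : ∀ {b b′} → Blue b → Blue b′ → b ≢ b′ → b ≢ q → b′ ≢ q → q ~ b → q ~ b′ → ⊥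
      two-blue-q pb pb′ b≢b′ b≢q b′≢q q~b q~b′ =
        -- `q` becomes white and `f` blue; a red twin blocking `q` recreates the situation with `q`
        -- as the white edge and `f` as the guard.
        add S.swap-max j≢i S.swap-e (λ emp → emp _ (S.swap-j b≢q pb) q~b) λ {e} pe T →
          Distant.two-red S.swap-max i≢j S.swap-e pe
            (λ q~e → S′ pe q~e T) T
            (λ pr q~r → f , S.swap-f , ~-sym (from t (S.unswap-i pr) q~r) , f≁q ∘ ~-sym)
            (S.swap-j b≢q pb) (S.swap-j b′≢q pb′) b≢b′ q~b q~b′
        where
        S′ : ∀ {e} → S.d e ≡ just j → q ~ e → ¬ Twin S.d i q e
        S′ pe q~e T = f≁q (~-sym (from T S.swap-f (~-sym (from t (S.unswap-i pe) q~e))))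

-- Absence of white edges, and the smaller colour class.

module Bound {n m : ℕ} (G : Graph n m) (twin-free : EdgeTwinFree G) (no-isolated : NoIsolatedEdge G) where
  open Incidence G
  open Colouring G
  open Moves G
  open Adjacent G twin-free
  open Cases G twin-free

  degree-one : ∀ {v f} → v ∈ᵉ f → (∀ {g} → v ∈ᵉ g → g ≡ f) → degree G v ≡ 1
  degree-one {v} {f} v∈f unique = trans (cong ∣_∣ (⊆-antisym sub sup)) (∣⁅x⁆∣≡1 f)
    where
    sub : tabulate (incidentᵇ G v) ⊆ ⁅ f ⁆
    sub {x} x∈ = subst (_∈ ⁅ f ⁆) (sym (unique (decidable-stable (v ∈ᵉ? x) λ v∉x →
      case-absurd (trans (sym (∈-tabulate⁻ {P = incidentᵇ G v} x∈)) (dec-false (v ∈ᵉ? x) v∉x))))) (x∈⁅x⁆ f)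
      where
      case-absurd : true ≡ false → ⊥
      case-absurd ()
    sup : ⁅ f ⁆ ⊆ tabulate (incidentᵇ G v)
    sup x∈ with x∈⁅y⁆⇒x≡y f x∈
    ... | refl = ∈-tabulate⁺ {P = incidentᵇ G v} (dec-true (v ∈ᵉ? f) v∈f)

  neighbour : ∀ {f} → (∀ {g} → g ≢ f → ¬ f ~ g) → ⊥
  neighbour {f} none = no-isolated f (one (inj₁ refl) , one (inj₂ refl))
    where
    one : ∀ {v} → v ∈ᵉ f → degree G v ≡ 1
    one v∈f = degree-one v∈f λ {g} v∈g → decidable-stable (g ≟ f) λ g≢f → none g≢f (at v∈f v∈g)

  complete : ∀ {c f} → Max c → c f ≢ nothing
  complete {c} {f} M wf = em {Empty c false f}
    (λ E → em {Empty c true f}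
      (λ E′ → neighbour (solitary E E′))
      (λ ne → add M f≢t wf ne λ pq t → distant M t≢f wf pq (E _ pq) t (inj₁ E)))
    λ ne → add M t≢f wf ne λ {e} pe te → em {Empty c true f}
      (λ E → distant M f≢t wf pe (E _ pe) te (inj₁ E))
      λ ne′ → add M f≢t wf ne′ λ {q} pq tq → em {f ~ e}
        (adjacent pe te pq tq)
        λ f≁e → distant M t≢f wf pq
          -- Either both twins meet `f` or neither does: if `f` meets `q`, then so does `e`, and `f`
          -- meets `e` because `q` does.
          (λ f~q → f≁e (from tq pe (~-sym (to te pq f~q)))) tq (inj₂ (e , pe , f≁e , te))
    where
    t≢f : true ≢ false
    t≢f ()
    f≢t : false ≢ true
    f≢t ()
    open At M t≢f
    -- Both ends of `f` are bare, so another edge `g` at one of them is white and `joint` applies.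
    solitary : Empty c false f → Empty c true f → ∀ {g} → g ≢ f → ¬ f ~ g
    solitary E E′ {g} g≢f (at v∈f v∈g) with opposite v∈f | opposite v∈g
    ... | u , Jf | z , Jg = coloured? c g
        (λ wg → joint M t≢f wf wg (flip Jf) (flip Jg) (λ { refl → g≢f (no-parallel Jg v∈f (right Jf)) })
          λ { {k = false} v∈x q → E _ q (at v∈f v∈x) ; {k = true} v∈x q → E′ _ q (at v∈f v∈x) })
        (λ { {false} q → E _ q (at v∈f v∈g) ; {true} q → E′ _ q (at v∈f v∈g) })
    -- `q` meets `e` because `f` does. At the common end of `f` and `e` this makes a star; at the
    -- other end of `e`, `f` must meet `q` as well, and unless `q` contains `u` a triangle closes.
    adjacent : ∀ {e q} → Red e → Twin c false f e → Blue q → Twin c true f q → f ~ e → ⊥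
    adjacent pe te pq tq (at u∈f u∈e) with opposite u∈f | opposite u∈e
    ... | v , Jf | y , Je with meets Je (~-sym (to tq pe (at u∈f u∈e)))
    ... | inj₁ u∈q = star M t≢f wf pe pq Jf Je (proj₂ (opposite u∈q)) te tq
    ... | inj₂ y∈q with meets Jf (from te pq (at (right Je) y∈q))
    ... | inj₁ u∈q = star M t≢f wf pe pq Jf Je (proj₂ (opposite u∈q)) te tq
    ... | inj₂ v∈q = triangle M t≢f wf pe pq (flip Jf) Je
                       (joins v∈q y∈q λ { refl → only Jf wf pe u∈e (right Je) }) te tq

  maximum : (∀ {c} → ¬ Max c) → ⊥
  maximum none = descend (λ _ → nothing) (<-wellFounded _) λ _ → record { dominated = λ () ; separated = λ () }
    where
    descend : ∀ c → Acc _<_ ∣ whites c ∣ → Good c → ⊥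
    descend c (acc rs) g = none record { isGood = g ; maximal = λ {c′} g′ lt → descend c′ (rs lt) g′ }

  locating : ∀ {c j i} {D : Subset m} → j ≢ i → Good c →
    (∀ {e} → e ∉ D → c e ≡ just j) → (∀ {e} → e ∈ D → c e ≡ just i) → (∀ {e} → c e ≡ just i → e ∈ D) →
    IsEdgeLocDom G D
  locating {c} {j} {i} {D} j≢i g out in′ in″ = dom , sep
    where
    dom : ∀ e → e ∉ D → Σ (Fin m) λ g → g ∈ D × shareEnd G e g
    dom e e∉D = decidable-stable
      (any? λ g → (g ∈? D) ×-dec (any? λ v → (v ∈ᵉ? e) ×-dec (v ∈ᵉ? g)))
      λ none → dominated (g j≢i) (out e∉D) λ { g p (at x y) → none (g , in″ p , _ , x , y) }
    sep : ∀ e f → e ∉ D → f ∉ D → e ≢ f → ¬ (∀ g → g ∈ D → (InN G e g ⇔ InN G f g))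
    sep e f e∉D f∉D e≢f same = e≢f (separated (g j≢i) (out e∉D) (out f∉D)
      (twin (λ { p (at x y) → half (Equivalence.to (same _ (in″ p)) (differ e∉D (in″ p) , _ , x , y)) })
            (λ { p (at x y) → half (Equivalence.from (same _ (in″ p)) (differ f∉D (in″ p) , _ , x , y)) })))
      where
      differ : ∀ {e g} → e ∉ D → g ∈ D → g ≢ e
      differ e∉D g∈D refl = e∉D g∈D
      half : ∀ {e g} → InN G e g → e ~ g
      half (_ , _ , x , y) = at x y

  locDom? : ∀ D → Dec (IsEdgeLocDom G D)
  locDom? D =
    all? (λ e → ¬? (e ∈? D) →-dec any? λ g → (g ∈? D) ×-dec shareEnd? e g)
    ×-dec
    all? (λ e → all? λ f → ¬? (e ∈? D) →-dec ¬? (f ∈? D) →-dec ¬? (e ≟ f) →-dec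
      ¬? (all? λ g → (g ∈? D) →-dec map′ (λ (x , y) → mk⇔ x y) (λ x → Equivalence.to x , Equivalence.from x)
        ((InN? e g →-dec InN? f g) ×-dec (InN? f g →-dec InN? e g))))
    where
    shareEnd? : ∀ e f → Dec (shareEnd G e f)
    shareEnd? e f = any? λ v → (v ∈ᵉ? e) ×-dec (v ∈ᵉ? f)
    InN? : ∀ e f → Dec (InN G e f)
    InN? e f = ¬? (f ≟ e) ×-dec shareEnd? e f

  smaller-half : ∀ d → ¬ 2 * d ≤ m → 2 * (m ∸ d) ≤ m
  smaller-half d large = begin
    2 * (m ∸ d)     ≡⟨ ℕ.*-distribˡ-∸ 2 m d ⟩
    2 * m ∸ 2 * d   ≤⟨ ℕ.∸-monoʳ-≤ (2 * m) (ℕ.<⇒≤ (ℕ.≰⇒> large)) ⟩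
    2 * m ∸ m       ≡⟨ ℕ.m+n∸m≡n m (m + 0) ⟩
    m + 0           ≡⟨ ℕ.+-identityʳ m ⟩
    m               ∎
    where open ℕ.≤-Reasoning

  smaller-class : Σ (Subset m) λ D → IsEdgeLocDom G D × (2 * ∣ D ∣ ≤ m)
  smaller-class = decidable-stable (anySubset? λ D → locDom? D ×-dec (2 * ∣ D ∣ ℕ.≤? m)) λ none →
    maximum λ {c} M → none (half M)
    where
    half : ∀ {c} → Max c → Σ (Subset m) λ D → IsEdgeLocDom G D × (2 * ∣ D ∣ ≤ m)
    half {c} M = [ (λ small → D , locating {D = D} (λ ()) (isGood M) outD inD D∋ , small)
                 , (λ large → ∁ D
                   , locating {D = ∁ D} (λ ()) (isGood M) (inD ∘ x∉∁p⇒x∈p) (outD ∘ x∈∁p⇒x∉p) (x∉p⇒x∈∁p ∘ D∌)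
                   , subst (λ d → 2 * d ≤ m) (sym (∣∁p∣≡n∸∣p∣ D)) (smaller-half ∣ D ∣ large)) ]′
                 (toSum (2 * ∣ D ∣ ℕ.≤? m))
      where
      isTrue : Fin m → Bool
      -- White edges would land in the `false` class; `complete` shows that there are none.
      isTrue e = fromMaybe false (c e)
      D : Subset m
      D = tabulate isTrue
      D∋ : ∀ {e} → c e ≡ just true → e ∈ D
      D∋ p = ∈-tabulate⁺ {P = isTrue} (cong (fromMaybe false) p)
      inD : ∀ {e} → e ∈ D → c e ≡ just true
      inD {e} x with c e | ∈-tabulate⁻ {P = isTrue} x
      ... | just true | _ = refl
      D∌ : ∀ {e} → c e ≡ just false → e ∉ D
      D∌ p x with trans (sym p) (inD x)
      ... | ()
      outD : ∀ {e} → e ∉ D → c e ≡ just false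
      outD {e} e∉ with c e in eq
      ... | just false = refl
      ... | just true = contradiction (D∋ eq) e∉
      ... | nothing = contradiction eq (complete M)

theorem2 : (n m : ℕ) (G : Graph n m) → EdgeTwinFree G → NoIsolatedEdge G →
    Σ (Subset m) λ D → IsEdgeLocDom G D × (2 * ∣ D ∣ ≤ m)
theorem2 _ _ G twin-free no-isolated = Bound.smaller-class G twin-free no-isolated
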